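{- Let $m,n\in\mathbb{N}$ and let $a,b$ be integers with $1\le a\le n$ and $1\le b\le m$. Let $\mathcal{Z}=R_{a,b}$. Then $$\gamma(\mathcal{Z},m,n)=\min_{\substack{b\le x\le m\\ a\le y\le n}}\bigl((m-x)(n-y)+\max(ax,by)\bigr),$$ where $x,y$ range over integers, and this quantity can be computed in time $\mathcal{O}(\min(a,b)/\gcd(a,b))$. In particular, for $a=b$ and $m=n$, $$\gamma(\mathcal{Z},n,n)=\begin{cases} an-a^2/4, & \text{if } a\le 2n/3 \text{ and } a \text{ is even},\\ an-(a^2-1)/4, & \text{if } a\le (2n+1)/3 \text{ and } a \text{ is odd},\\ a^2+(n-a)^2, & \text{otherwise}.\end{cases}$$
   Context: $\mathbb{Z}_+=\{0,1,2,\dots\}$, $\mathbb{N}=\{1,2,\dots\}$, $[0,c]=\{0,1,\dots,c\}$, and $R_{a,b}=[0,a-1]\times[0,b-1]$. A zero-set (Young diagram) is a downward-closed set $\mathcal{Z}\subseteq\mathbb{Z}_+^2$; $\emptyset$ and infinite sets are allowed. For $m,n\in\mathbb{N}$, the graph $K_m\Box K_n$ is represented on the vertex set $R_{n,m}=[0,n-1]\times[0,m-1]$, with two vertices adjacent iff they differ in exactly one coordinate. For $v=(j,i)\in R_{n,m}$, the row neighborhood $\mathcal{N}^r(v)$ is the set of all $(j',i)\in R_{n,m}$ with $j'\neq j$, and the column neighborhood $\mathcal{N}^c(v)$ is the set of all $(j,i')\in R_{n,m}$ with $i'\ne i$. Given $\mathcal{Z}$, for $A\subseteq R_{n,m}$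 let $\mathcal{T}(A)=A\cup\{v\in R_{n,m}\setminus A\colon (|\mathcal{N}^r(v)\cap A|,|\mathcal{N}^c(v)\cap A|)\notin\mathcal{Z}\}$. Then $\gamma(\mathcal{Z},m,n)=\min\{|A|\colon A\subseteq R_{n,m},\ \mathcal{T}(A)=R_{n,m}\}$. The running time is that of an algorithm with input integers $a,b,m,n$, counted in elementary arithmetic operations and comparisons on integers (unit cost). -}

module Defs where

open import Data.Bool.Base using (Bool; true; false; if_then_else_)
open import Data.Bool.Properties using () renaming (_≟_ to _≟ᵇ_)
open import Data.Fin.Base using (Fin; remQuot; combine)
open import Data.Fin.Properties using () renaming (_≟_ to _≟ᶠ_)
open import Data.Fin.Subset using (Subset; _∪_; _∩_; ∣_∣; ⊤)
open import Data.Fin.Subset.Properties using (_∈?_; anySubset?; p⊆p∪q; ⊆-antisym; ⊆-max)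
open import Data.Integer.Base as ℤ using (ℤ; +_; -[1+_])
open import Data.Integer.Properties as ℤ using ()
open import Data.Nat.Base
open import Data.Nat.GCD using (gcd; gcd[m,n]≢0)
open import Data.Nat.Properties using (_≟_; _<?_; ≤-<-trans)
open import Data.Product.Base using (∃; ∃-syntax; _×_; _,_; proj₁; proj₂)
open import Data.Sum.Base using (inj₁)
open import Data.Vec.Base using (tabulate)
open import Data.Vec.Properties using (≡-dec)
open import Function.Base using (_∘_)
open import Level using (0ℓ)
open import Relation.Binary.PropositionalEquality using (_≡_; refl)
open import Relation.Nullary.Decidable using (Dec; does; yes; no; ¬?; _×-dec_)
open import Relation.Nullary.Negation using (contradiction)
open import Relation.Unary using (Pred; Decidable)

infix 4 _IsMinimumOf_

_IsMinimumOf_ : ℕ → Pred ℕ 0ℓ → Set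
k IsMinimumOf P = P k × (∀ l → P l → k ≤ l)

minimum : {P : Pred ℕ 0ℓ} → Decidable P → ∀ k → P k → ∃ (_IsMinimumOf P)
minimum P? zero p = zero , p , λ _ _ → z≤n
minimum {P} P? (suc k) p with P? zero
... | yes p₀ = zero , p₀ , λ _ _ → z≤n
... | no ¬p₀ with minimum (P? ∘ suc) k p
...   | l , pl , least = suc l , pl , least′
  where
  least′ : ∀ i → P i → suc l ≤ i
  least′ zero    p₀ = contradiction p₀ ¬p₀
  least′ (suc i) pᵢ = s≤s (least i pᵢ)

-- Membership is required to be decidable so that γ below is a function.
record ZeroSet : Set₁ where
  field
    Mem    : ℕ → ℕ → Set
    mem?   : ∀ p q → Dec (Mem p q)
    closed : ∀ {p q p′ q′} → p′ ≤ p → q′ ≤ q → Mem p q → Mem p′ q′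

R : ℕ → ℕ → ZeroSet
R a b = record
  { Mem    = λ p q → p < a × q < b
  ; mem?   = λ p q → (p <? a) ×-dec (q <? b)
  ; closed = λ p′≤p q′≤q (p<a , q<b) → ≤-<-trans p′≤p p<a , ≤-<-trans q′≤q q<b
  }

Vertex : ℕ → ℕ → Set
Vertex m n = Fin n × Fin m

-- Sets of vertices are subsets of Fin (n * m), where the vertex (j , i) is
-- the element combine j i.
VertexSet : ℕ → ℕ → Set
VertexSet m n = Subset (n * m)

module _ {m n : ℕ} where

  ⟦_⟧ : {P : Pred (Vertex m n) 0ℓ} → Decidable P → VertexSet m n
  ⟦ P? ⟧ = tabulate (λ w → does (P? (remQuot m w)))

  Nʳ : Vertex m n → VertexSet m n
  Nʳ (j , i) = ⟦ (λ (j′ , i′) → ¬? (j′ ≟ᶠ j) ×-dec (i′ ≟ᶠ i)) ⟧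

  Nᶜ : Vertex m n → VertexSet m n
  Nᶜ (j , i) = ⟦ (λ (j′ , i′) → (j′ ≟ᶠ j) ×-dec ¬? (i′ ≟ᶠ i)) ⟧

  𝒯 : ZeroSet → VertexSet m n → VertexSet m n
  𝒯 Z A = A ∪ ⟦ (λ v → ¬? (combine (proj₁ v) (proj₂ v) ∈? A) ×-dec
                       ¬? (mem? ∣ Nʳ v ∩ A ∣ ∣ Nᶜ v ∩ A ∣)) ⟧
    where open ZeroSet Z

OneStepSpanningSize : ZeroSet → ℕ → ℕ → Pred ℕ 0ℓ
OneStepSpanningSize Z m n k = ∃[ A ] ∣ A ∣ ≡ k × 𝒯 {m} {n} Z A ≡ ⊤

γ-exists : ∀ Z m n → ∃ (_IsMinimumOf OneStepSpanningSize Z m n)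
γ-exists Z m n = minimum
  (λ k → anySubset? (λ A → (∣ A ∣ ≟ k) ×-dec ≡-dec _≟ᵇ_ (𝒯 {m} {n} Z A) ⊤))
  ∣ ⊤ {n * m} ∣ (⊤ , refl , ⊆-antisym (⊆-max _) (p⊆p∪q _))

γ : ZeroSet → ℕ → ℕ → ℕ
γ Z m n = proj₁ (γ-exists Z m n)

-- The truncated subtractions are exact on the range of x and y.
ObjectiveValue : (a b m n : ℕ) → Pred ℕ 0ℓ
ObjectiveValue a b m n k =
  ∃[ x ] ∃[ y ] (b ≤ x × x ≤ m) × (a ≤ y × y ≤ n) ×
    k ≡ (m ∸ x) * (n ∸ y) + (a * x ⊔ b * y)

instance
  gcd-nonZero : ∀ {a b} → .{{NonZero a}} → NonZero (gcd a b)
  gcd-nonZero {a} {b} = ≢-nonZero (gcd[m,n]≢0 a b (inj₁ (≢-nonZero⁻¹ a)))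

-- Algorithms are programs of a while-language over integer variables.  A
-- program is finite syntax, independent of the input, so it can mention only
-- finitely many variables and constants.  Each arithmetic operation and each
-- comparison costs one unit; reading, writing and copying a variable is free,
-- but every branch and every loop iteration pays for its comparison.

Var : Set
Var = ℕ

Store : Set
Store = Var → ℤ

_[_↦_] : Store → Var → ℤ → Store
(s [ x ↦ i ]) y = if does (y ≟ x) then i else s y

data Op : Set where
  add sub mul div : Op

infix 9 `_ #_

data Expr : Set where
  `_   : Var → Expr
  #_   : ℤ → Expr
  _⟨_⟩_ : Expr → Op → Expr → Expr

infixl 6 _⟨_⟩_
infix 5 _≤ᵉ_ _=ᵉ_

data Test : Set where
  _≤ᵉ_ _=ᵉ_ : Expr → Expr → Test

infix  4 _:=_
infixr 3 _⨾_

data Program : Set where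
  skip          : Program
  _:=_          : Var → Expr → Program
  _⨾_           : Program → Program → Program
  IF_THEN_ELSE_ : Test → Program → Program → Program
  WHILE_LOOP_   : Test → Program → Program

-- Division with remainder in [0 , ∣ j ∣), so the floor of i / j for j > 0;
-- division by zero is given the value 0.
_÷_ : ℤ → ℤ → ℤ
i ÷ (+ zero)      = + 0
i ÷ j@(+ (suc _)) = i ℤ./ j
i ÷ j@(-[1+ _ ])  = i ℤ./ j

⟦_⟧ᵒ : Op → ℤ → ℤ → ℤ
⟦ add ⟧ᵒ = ℤ._+_
⟦ sub ⟧ᵒ = ℤ._-_
⟦ mul ⟧ᵒ = ℤ._*_
⟦ div ⟧ᵒ = _÷_

eval : Expr → Store → ℤ
eval (` x)         s = s x
eval (# i)         s = i
eval (e ⟨ op ⟩ e′) s = ⟦ op ⟧ᵒ (eval e s) (eval e′ s)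

cost : Expr → ℕ
cost (` _)        = 0
cost (# _)        = 0
cost (e ⟨ _ ⟩ e′) = 1 + cost e + cost e′

test : Test → Store → Bool
test (e ≤ᵉ e′) s = does (eval e s ℤ.≤? eval e′ s)
test (e =ᵉ e′) s = does (eval e s ℤ.≟ eval e′ s)

testCost : Test → ℕ
testCost (e ≤ᵉ e′) = 1 + cost e + cost e′
testCost (e =ᵉ e′) = 1 + cost e + cost e′

infix 2 _,_⇓[_]_

-- P , s ⇓[ t ] s′ : started in s, the program P halts in s′ after t units.
data _,_⇓[_]_ : Program → Store → ℕ → Store → Set where
  ⇓skip  : ∀ {s} → skip , s ⇓[ 0 ] s
  ⇓:=    : ∀ {x e s} → (x := e) , s ⇓[ cost e ] s [ x ↦ eval e s ]
  ⇓⨾     : ∀ {P Q s s′ s″ t t′} →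
           P , s ⇓[ t ] s′ → Q , s′ ⇓[ t′ ] s″ → (P ⨾ Q) , s ⇓[ t + t′ ] s″
  ⇓then  : ∀ {c P Q s s′ t} → test c s ≡ true → P , s ⇓[ t ] s′ →
           (IF c THEN P ELSE Q) , s ⇓[ testCost c + t ] s′
  ⇓else  : ∀ {c P Q s s′ t} → test c s ≡ false → Q , s ⇓[ t ] s′ →
           (IF c THEN P ELSE Q) , s ⇓[ testCost c + t ] s′
  ⇓exit  : ∀ {c P s} → test c s ≡ false →
           (WHILE c LOOP P) , s ⇓[ testCost c ] s
  ⇓again : ∀ {c P s s′ s″ t t′} → test c s ≡ true →
           P , s ⇓[ t ] s′ → (WHILE c LOOP P) , s′ ⇓[ t′ ] s″ →
           (WHILE c LOOP P) , s ⇓[ testCost c + t + t′ ] s″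

-- The inputs are in variables 0 to 3; all other variables start at 0.
input : (a b m n : ℕ) → Store
input a b m n 0 = + a
input a b m n 1 = + b
input a b m n 2 = + m
input a b m n 3 = + n
input a b m n _ = + 0

-- The output is read from variable 0.
_onInput_yields_within_ : Program → Store → ℕ → ℕ → Set
P onInput s yields k within T =
  ∃[ t ] ∃[ s′ ] (P , s ⇓[ t ] s′) × s′ 0 ≡ + k × t ≤ T

{-# OPTIONS --safe #-}

-- Call a row good if it contains at least a chosen vertices, and a column good
-- if it contains at least b of them.  A set spans in one step iff it contains
-- every vertex on a bad row and a bad column.  With x good rows and y good
-- columns it has at least (m - x)(n - y) + max(a x, b y) elements, and when x < b
-- or y < a the same count, refined by inclusion-exclusion, is no better than a
-- value inside the range.  Conversely a staircase filling of the x × y block of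
-- good lines attains the bound.
--
-- For fixed y the objective is smallest next to the ridge a x = b y or at x = m,
-- where it is at least a m, its value at (m , a).  The points of ⌊b y / a⌋ and
-- ⌈b y / a⌉ split into p = a / gcd a b classes y = a + r + p t, and on each class
-- the objective is a convex quadratic in t, minimised in constant time; by symmetry
-- one may take a ≤ b.

module Submission where

open import Defs
open import Data.Bool.Base using (Bool; true; false; T; not; _∧_; if_then_else_)
open import Data.Bool.Properties using (∧-zeroʳ; T-≡; T-∧; T?)
open import Data.Fin.Base as Fin using (Fin; zero; suc; toℕ; combine; remQuot; _↑ˡ_; _↑ʳ_)
open import Data.Fin.Properties as Fin using (remQuot-combine; combine-remQuot)
open import Data.Fin.Subset using (Subset; _∩_; ∣_∣; ⊤; _∈_)
open import Data.Fin.Subset.Properties using (_∈?_; x∈p∪q⁺; x∈p∪q⁻; ∈⊤; ⊆-antisym; ⊆-max)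
open import Data.Integer.Base as ℤ using (ℤ; -[1+_])
import Data.Integer.DivMod as ℤ
import Data.Integer.Properties as ℤ
open import Data.Integer.Tactic.RingSolver using () renaming (solve-∀ to ℤ-solve-∀)
open import Data.Nat.Base
open import Data.Nat.DivMod
open import Data.Nat.Divisibility using (_∣_; _∤_; divides; ∣-refl; ∣⇒≤; m%n≡0⇒n∣m)
open import Data.Nat.GCD using (gcd; gcd[m,n]∣m; gcd[m,n]∣n)
open import Data.Nat.Properties
open import Data.Nat.Tactic.RingSolver using (solve-∀)
open import Data.Product.Base using (∃₂; ∃-syntax; _×_; _,_; proj₁; proj₂)
open import Data.Sum.Base as Sum using (_⊎_; inj₁; inj₂; [_,_]′)
open import Data.Unit.Base using (tt)
open import Data.Vec.Base using (_∷_; []; lookup)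
open import Data.Vec.Properties using (lookup∘tabulate; lookup-zipWith; lookup⇒[]=; []=⇒lookup)
open import Function.Base using (_∘_; flip)
open import Function.Bundles using (Equivalence)
open import Level using (0ℓ)
open import Relation.Binary.PropositionalEquality
open import Relation.Nullary.Decidable using (Dec; yes; no; does; dec-true; dec-false; ¬?; _×-dec_)
open import Relation.Nullary.Negation using (¬_; contradiction)
open import Relation.Unary using (Pred; Decidable)

open import Algebra.Properties.Semiring.Sum +-*-semiring
  using (sum; sum-syntax; sum-cong-≗; ∑-distrib-+; ∑-comm; *-distribˡ-sum; *-distribʳ-sum)

-- Sums and vertex sets

-- For the upper bound, only the larger of the two products has to be met exactly. If it is `a * x`,
-- each good row receives exactly `a` cells, and column counts that are spread evenly then reach `b`
-- by themselves; otherwise the grid is transposed. The time bound may not depend on `m` and `n`, so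
-- a scan over all `y` is ruled out. The way around is a step `(q , p)` with `a * q ≡ b * p`: it
-- raises both arguments of the maximum by the same amount, so the kink is never crossed and only
-- the product bends the objective. The same equation makes the rounding error of `b * y / a`
-- periodic with period `p`, so that a class that starts next to the ridge stays next to it. The
-- period is found by trial, at a constant cost for each number up to `p`, which is what the scan
-- over the `p` classes costs anyway.

sum-mono-≤ : ∀ {n} {f g : Fin n → ℕ} → (∀ i → f i ≤ g i) → sum f ≤ sum g
sum-mono-≤ {zero}  f≤g = z≤n
sum-mono-≤ {suc n} f≤g = +-mono-≤ (f≤g zero) (sum-mono-≤ (f≤g ∘ suc))

sum-const : ∀ n c → ∑[ _ < n ] c ≡ n * c
sum-const zero    c = refl
sum-const (suc n) c = cong (c +_) (sum-const n c)

sum-zero : ∀ {n} {f : Fin n → ℕ} → (∀ i → f i ≡ 0) → sum f ≡ 0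
sum-zero {n} f≡0 = trans (sum-cong-≗ f≡0) (trans (sum-const n 0) (*-zeroʳ n))

sum-single : ∀ {n} {f : Fin n → ℕ} i → (∀ k → k ≢ i → f k ≡ 0) → sum f ≡ f i
sum-single {f = f} zero    f≡0 =
  trans (cong (f zero +_) (sum-zero (λ k → f≡0 (suc k) (λ ())))) (+-identityʳ _)
sum-single {f = f} (suc i) f≡0 =
  trans (cong (_+ sum (f ∘ suc)) (f≡0 zero (λ ())))
        (sum-single i (λ k k≢i → f≡0 (suc k) (k≢i ∘ Fin.suc-injective)))

sum-++ : ∀ k {l} (f : Fin (k + l) → ℕ) →
         sum f ≡ ∑[ i < k ] f (i ↑ˡ l) + ∑[ i < l ] f (k ↑ʳ i)
sum-++ zero    f = refl
sum-++ (suc k) f =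
  trans (cong (f zero +_) (sum-++ k (f ∘ suc))) (sym (+-assoc (f zero) _ _))

sum-combine : ∀ k {l} (f : Fin (k * l) → ℕ) →
              sum f ≡ ∑[ i < k ] ∑[ j < l ] f (combine i j)
sum-combine zero        f = refl
sum-combine (suc k) {l} f =
  trans (sum-++ l f) (cong (sum (λ j → f (j ↑ˡ k * l)) +_) (sum-combine k (λ w → f (l ↑ʳ w))))

𝟙 : Bool → ℕ
𝟙 b = if b then 1 else 0

∣p∣≡sum : ∀ {n} (p : Subset n) → ∣ p ∣ ≡ ∑[ w < n ] 𝟙 (lookup p w)
∣p∣≡sum []          = refl
∣p∣≡sum (true  ∷ p) = cong suc (∣p∣≡sum p)
∣p∣≡sum (false ∷ p) = ∣p∣≡sum p

module _ {m n : ℕ} (α : Fin n → Fin m → Bool) where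

  rowCount : Fin m → ℕ
  rowCount i = ∑[ j < n ] 𝟙 (α j i)

  columnCount : Fin n → ℕ
  columnCount j = ∑[ i < m ] 𝟙 (α j i)

  total : ℕ
  total = ∑[ j < n ] columnCount j

  total≡∑rowCount : total ≡ ∑[ i < m ] rowCount i
  total≡∑rowCount = ∑-comm (λ j i → 𝟙 (α j i))

  -- Whole lines are counted instead of neighbourhoods without their centre: the counts differ only
  -- at chosen vertices, and those satisfy the first alternative.
  Spanning : ℕ → ℕ → Set
  Spanning a b = ∀ j i → α j i ≡ true ⊎ (a ≤ rowCount i ⊎ b ≤ columnCount j)

module _ {m n : ℕ} where

  cells : VertexSet m n → Fin n → Fin m → Bool
  cells A j i = lookup A (combine j i)

  ∣A∣≡total : ∀ A → ∣ A ∣ ≡ total (cells A)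
  ∣A∣≡total A = trans (∣p∣≡sum A) (sum-combine n _)

  module _ {P : Pred (Vertex m n) 0ℓ} (P? : Decidable P) where

    lookup-⟦⟧ : ∀ j i → lookup (⟦_⟧ {m} {n} P?) (combine j i) ≡ does (P? (j , i))
    lookup-⟦⟧ j i = trans (lookup∘tabulate _ (combine j i))
                          (cong (does ∘ P?) (remQuot-combine j i))

    ∣⟦⟧∩A∣ : ∀ A → ∣ ⟦ P? ⟧ ∩ A ∣ ≡ ∑[ j < n ] ∑[ i < m ] 𝟙 (does (P? (j , i)) ∧ cells A j i)
    ∣⟦⟧∩A∣ A = trans (∣A∣≡total (⟦ P? ⟧ ∩ A)) (sum-cong-≗ λ j → sum-cong-≗ λ i → cong 𝟙
      (trans (lookup-zipWith _∧_ (combine j i) ⟦ P? ⟧ A) (cong (_∧ cells A j i) (lookup-⟦⟧ j i))))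

    ∈⟦⟧⁺ : ∀ j i → P (j , i) → combine j i ∈ ⟦_⟧ {m} {n} P?
    ∈⟦⟧⁺ j i p = lookup⇒[]= _ _ (trans (lookup-⟦⟧ j i) (dec-true (P? (j , i)) p))

    ∈⟦⟧⁻ : ∀ j i → combine j i ∈ ⟦_⟧ {m} {n} P? → P (j , i)
    ∈⟦⟧⁻ j i ∈P with P? (j , i) | lookup-⟦⟧ j i
    ... | yes p | _  = p
    ... | no  _ | eq with () ← trans (sym ([]=⇒lookup ∈P)) eq

  module _ (A : VertexSet m n) {j : Fin n} {i : Fin m} (v∉A : cells A j i ≡ false) where

    -- The only cell of the row outside the neighbourhood is `(j , i)` itself, which adds 0 by
    -- `v∉A`.
    ∣Nʳ∩A∣ : ∣ Nʳ (j , i) ∩ A ∣ ≡ rowCount (cells A) i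
    ∣Nʳ∩A∣ = trans (∣⟦⟧∩A∣ neighbour? A) (sum-cong-≗ λ j′ →
      trans (sum-single i (λ i′ i′≢i → off-row j′ i′ i′≢i)) (on-row j′))
      where
      neighbour? : Decidable {A = Vertex m n} (λ (j′ , i′) → j′ ≢ j × i′ ≡ i)
      neighbour? (j′ , i′) = ¬? (j′ Fin.≟ j) ×-dec (i′ Fin.≟ i)
      off-row : ∀ j′ i′ → i′ ≢ i →
        𝟙 ((not (does (j′ Fin.≟ j)) ∧ does (i′ Fin.≟ i)) ∧ cells A j′ i′) ≡ 0
      off-row j′ i′ i′≢i rewrite dec-false (i′ Fin.≟ i) i′≢i | ∧-zeroʳ (not (does (j′ Fin.≟ j))) = refl
      on-row : ∀ j′ →
        𝟙 ((not (does (j′ Fin.≟ j)) ∧ does (i Fin.≟ i)) ∧ cells A j′ i) ≡ 𝟙 (cells A j′ i)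
      on-row j′ rewrite dec-true (i Fin.≟ i) refl with j′ Fin.≟ j
      ... | yes refl = cong 𝟙 (sym v∉A)
      ... | no  _    = refl

    ∣Nᶜ∩A∣ : ∣ Nᶜ (j , i) ∩ A ∣ ≡ columnCount (cells A) j
    ∣Nᶜ∩A∣ = trans (∣⟦⟧∩A∣ neighbour? A) (trans (sum-single j off-column) (sum-cong-≗ on-column))
      where
      neighbour? : Decidable {A = Vertex m n} (λ (j′ , i′) → j′ ≡ j × i′ ≢ i)
      neighbour? (j′ , i′) = (j′ Fin.≟ j) ×-dec ¬? (i′ Fin.≟ i)
      off-column : ∀ j′ → j′ ≢ j →
        ∑[ i′ < m ] 𝟙 ((does (j′ Fin.≟ j) ∧ not (does (i′ Fin.≟ i))) ∧ cells A j′ i′) ≡ 0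
      off-column j′ j′≢j rewrite dec-false (j′ Fin.≟ j) j′≢j = sum-zero {m} (λ _ → refl)
      on-column : ∀ i′ →
        𝟙 ((does (j Fin.≟ j) ∧ not (does (i′ Fin.≟ i))) ∧ cells A j i′) ≡ 𝟙 (cells A j i′)
      on-column i′ rewrite dec-true (j Fin.≟ j) refl with i′ Fin.≟ i
      ... | yes refl = cong 𝟙 (sym v∉A)
      ... | no  _    = refl

  module _ {a b : ℕ} (A : VertexSet m n) where

    private
      -- Copies the comprehension inside `𝒯` for `R a b`, so that `⟦ joins? ⟧` is the second part of
      -- that union by definition.
      Joins : Pred (Vertex m n) 0ℓ
      Joins v = ¬ (combine (proj₁ v) (proj₂ v) ∈ A) ×
                ¬ (∣ Nʳ v ∩ A ∣ < a × ∣ Nᶜ v ∩ A ∣ < b)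

      joins? : Decidable Joins
      joins? v = ¬? (combine (proj₁ v) (proj₂ v) ∈? A) ×-dec
                 ¬? ((∣ Nʳ v ∩ A ∣ <? a) ×-dec (∣ Nᶜ v ∩ A ∣ <? b))

    𝒯≡⊤⇒Spanning : 𝒯 {m} {n} (R a b) A ≡ ⊤ → Spanning (cells A) a b
    𝒯≡⊤⇒Spanning 𝒯≡⊤ j i with cells A j i in eq
    ... | true  = inj₁ refl
    ... | false with x∈p∪q⁻ A ⟦ joins? ⟧ (subst (combine j i ∈_) (sym 𝒯≡⊤) ∈⊤)
    ...   | inj₁ v∈A with () ← trans (sym ([]=⇒lookup v∈A)) eq
    ...   | inj₂ v∈ with ∈⟦⟧⁻ joins? j i v∈
    ...     | _ , outside rewrite ∣Nʳ∩A∣ A eq | ∣Nᶜ∩A∣ A eq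
      with a ≤? rowCount (cells A) i | b ≤? columnCount (cells A) j
    ...       | yes a≤ | _      = inj₂ (inj₁ a≤)
    ...       | no  _  | yes b≤ = inj₂ (inj₂ b≤)
    ...       | no  a≰ | no  b≰ = contradiction (≰⇒> a≰ , ≰⇒> b≰) outside

    Spanning⇒𝒯≡⊤ : Spanning (cells A) a b → 𝒯 {m} {n} (R a b) A ≡ ⊤
    Spanning⇒𝒯≡⊤ spanning = ⊆-antisym (⊆-max _) λ {w} _ →
      subst (_∈ 𝒯 {m} {n} (R a b) A) (combine-remQuot {n} m w) 
        (covered (proj₁ (remQuot {n} m w)) (proj₂ (remQuot {n} m w)))
      where
      covered : ∀ j i → combine j i ∈ 𝒯 {m} {n} (R a b) A
      covered j i with cells A j i in eq
      ... | true  = x∈p∪q⁺ (inj₁ (lookup⇒[]= _ A eq))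
      ... | false = x∈p∪q⁺ (inj₂ (∈⟦⟧⁺ joins? j i (v∉A , outside (spanning j i))))
        where
        v∉A : ¬ combine j i ∈ A
        v∉A v∈A with () ← trans (sym ([]=⇒lookup v∈A)) eq
        outside : cells A j i ≡ true ⊎ (a ≤ rowCount (cells A) i ⊎ b ≤ columnCount (cells A) j) →
                  ¬ (∣ Nʳ (j , i) ∩ A ∣ < a × ∣ Nᶜ (j , i) ∩ A ∣ < b)
        outside (inj₁ v∈A) with () ← trans (sym v∈A) eq
        outside (inj₂ large) (r<a , c<b) rewrite ∣Nʳ∩A∣ A eq | ∣Nᶜ∩A∣ A eq =
          [ <⇒≱ r<a , <⇒≱ c<b ]′ large

  fromCells : (Fin n → Fin m → Bool) → VertexSet m n
  fromCells α = ⟦_⟧ {m} {n} (λ (j , i) → T? (α j i))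

  cells-fromCells : ∀ α j i → cells (fromCells α) j i ≡ α j i
  cells-fromCells α = lookup-⟦⟧ (λ (j , i) → T? (α j i))

γ-cells : ∀ a b m n → ∃[ α ] Spanning {m} {n} α a b × total α ≡ γ (R a b) m n
γ-cells a b m n with γ-exists (R a b) m n
... | _ , (A , ∣A∣≡k , 𝒯≡⊤) , _ =
  cells {m} {n} A , 𝒯≡⊤⇒Spanning {m} {n} A 𝒯≡⊤ , trans (sym (∣A∣≡total {m} {n} A)) ∣A∣≡k

γ≤total : ∀ {a b m n} (α : Fin n → Fin m → Bool) → Spanning α a b → γ (R a b) m n ≤ total α
γ≤total {a} {b} {m} {n} α spanning =
  ≤-trans (proj₂ (proj₂ (γ-exists (R a b) m n)) _ (A , refl , Spanning⇒𝒯≡⊤ A spanning′))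
          (≤-reflexive (trans (∣A∣≡total {m} {n} A) (sum-cong-≗ λ j → columnCount≡ j)))
  where
  A : VertexSet m n
  A = fromCells α
  rowCount≡ : ∀ i → rowCount (cells {m} {n} A) i ≡ rowCount α i
  rowCount≡ i = sum-cong-≗ λ j → cong 𝟙 (cells-fromCells {m} {n} α j i)
  columnCount≡ : ∀ j → columnCount (cells {m} {n} A) j ≡ columnCount α j
  columnCount≡ j = sum-cong-≗ λ i → cong 𝟙 (cells-fromCells {m} {n} α j i)
  spanning′ : Spanning (cells {m} {n} A) a b
  spanning′ j i = Sum.map (trans (cells-fromCells {m} {n} α j i))
    (Sum.map (subst (a ≤_) (sym (rowCount≡ i))) (subst (b ≤_) (sym (columnCount≡ j)))) (spanning j i)

-- The lower bound

objective : (a b m n x y : ℕ) → ℕ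
objective a b m n x y = (m ∸ x) * (n ∸ y) + (a * x ⊔ b * y)

sum-𝟙-not : ∀ {n} (β : Fin n → Bool) → sum (𝟙 ∘ not ∘ β) ≡ n ∸ sum (𝟙 ∘ β)
sum-𝟙-not {n} β = trans (sym (m+n∸n≡m _ (sum (𝟙 ∘ β)))) (cong (λ t → t ∸ sum (𝟙 ∘ β)) complement)
  where
  one : ∀ c → 𝟙 (not c) + 𝟙 c ≡ 1
  one true  = refl
  one false = refl
  complement : sum (𝟙 ∘ not ∘ β) + sum (𝟙 ∘ β) ≡ n
  complement = trans (sym (∑-distrib-+ {n} (𝟙 ∘ not ∘ β) (𝟙 ∘ β)))
    (trans (sum-cong-≗ {n} (one ∘ β)) (trans (sum-const n 1) (*-identityʳ n)))

∑∑-* : ∀ {k l} (f : Fin k → ℕ) (g : Fin l → ℕ) → ∑[ i < k ] ∑[ j < l ] (f i * g j) ≡ sum f * sum g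
∑∑-* f g = trans (sum-cong-≗ λ i → sym (*-distribˡ-sum (f i) g)) (sym (*-distribʳ-sum (sum g) f))

∑∑-distrib-+ : ∀ {k l} (f g : Fin k → Fin l → ℕ) →
  ∑[ i < k ] ∑[ j < l ] (f i j + g i j) ≡ ∑[ i < k ] ∑[ j < l ] f i j + ∑[ i < k ] ∑[ j < l ] g i j
∑∑-distrib-+ f g = trans (sum-cong-≗ λ i → ∑-distrib-+ (f i) (g i))
  (∑-distrib-+ (λ i → sum (f i)) (λ i → sum (g i)))

∑∑-mono : ∀ {k l} {f g : Fin k → Fin l → ℕ} → (∀ i j → f i j ≤ g i j) →
  ∑[ i < k ] ∑[ j < l ] f i j ≤ ∑[ i < k ] ∑[ j < l ] g i j
∑∑-mono f≤g = sum-mono-≤ λ i → sum-mono-≤ (f≤g i)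

weighted-sum-≥ : ∀ {k} c (f : Fin k → ℕ) (β : Fin k → Bool) → (∀ i → β i ≡ true → c ≤ f i) →
  c * sum (𝟙 ∘ β) ≤ ∑[ i < k ] (𝟙 (β i) * f i)
weighted-sum-≥ c f β c≤f = ≤-trans (≤-reflexive (*-distribˡ-sum c (𝟙 ∘ β))) (sum-mono-≤ λ i → pointwise i (β i) refl)
  where
  pointwise : ∀ i t → β i ≡ t → c * 𝟙 (β i) ≤ 𝟙 (β i) * f i
  pointwise i true  eq rewrite eq | *-identityʳ c | +-identityʳ (f i) = c≤f i eq
  pointwise i false eq rewrite eq | *-zeroʳ c = z≤n

module _ {a b m n : ℕ} (α : Fin n → Fin m → Bool) (spanning : Spanning α a b) where

  private
    good-row : Fin m → Bool
    good-row i = does (a ≤? rowCount α i)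

    good-column : Fin n → Bool
    good-column j = does (b ≤? columnCount α j)

    X Y : ℕ
    X = sum (𝟙 ∘ good-row)
    Y = sum (𝟙 ∘ good-column)

    good-row⇒ : ∀ i → good-row i ≡ true → a ≤ rowCount α i
    good-row⇒ i eq = ≤ᵇ⇒≤ a _ (Equivalence.from T-≡ eq)

    good-column⇒ : ∀ j → good-column j ≡ true → b ≤ columnCount α j
    good-column⇒ j eq = ≤ᵇ⇒≤ b _ (Equivalence.from T-≡ eq)

    bad : Fin n → Fin m → ℕ
    bad j i = 𝟙 (not (good-column j)) * 𝟙 (not (good-row i))

    row-part column-part : Fin n → Fin m → ℕ
    row-part    j i = 𝟙 (good-row i) * 𝟙 (α j i)
    column-part j i = 𝟙 (good-column j) * 𝟙 (α j i)

    bad-full : ∀ j i → good-column j ≡ false → good-row i ≡ false → α j i ≡ true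
    bad-full j i ¬c ¬r with spanning j i
    ... | inj₁ full = full
    ... | inj₂ (inj₁ r) with () ← trans (sym (dec-true (a ≤? rowCount α i) r)) ¬r
    ... | inj₂ (inj₂ c) with () ← trans (sym (dec-true (b ≤? columnCount α j) c)) ¬c

    ∑bad : ∑[ j < n ] ∑[ i < m ] bad j i ≡ (m ∸ X) * (n ∸ Y)
    ∑bad = trans (∑∑-* (𝟙 ∘ not ∘ good-column) (𝟙 ∘ not ∘ good-row)) 
      (trans (cong₂ _*_ (sum-𝟙-not good-column) (sum-𝟙-not good-row)) (*-comm (n ∸ Y) (m ∸ X)))

    ∑row-part : a * X ≤ ∑[ j < n ] ∑[ i < m ] row-part j i
    ∑row-part = ≤-trans (weighted-sum-≥ a (rowCount α) good-row good-row⇒)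
      (≤-reflexive (trans (sum-cong-≗ {m} λ i → *-distribˡ-sum (𝟙 (good-row i)) (λ j → 𝟙 (α j i)))
                          (∑-comm (λ i j → row-part j i))))

    ∑column-part : b * Y ≤ ∑[ j < n ] ∑[ i < m ] column-part j i
    ∑column-part = ≤-trans (weighted-sum-≥ b (columnCount α) good-column good-column⇒)
      (≤-reflexive (sum-cong-≗ λ j → *-distribˡ-sum (𝟙 (good-column j)) (𝟙 ∘ α j)))

    -- A bad cell must be chosen and lies on no good row, so no chosen cell is charged twice.
    bad+row-part≤α : ∀ j i → bad j i + row-part j i ≤ 𝟙 (α j i)
    bad+row-part≤α j i with good-column j in c | good-row i in r | α j i in v
    ... | true  | true  | true  = ≤-refl
    ... | true  | true  | false = ≤-refl
    ... | true  | false | _     = z≤n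
    ... | false | true  | true  = ≤-refl
    ... | false | true  | false = ≤-refl
    ... | false | false | true  = ≤-refl
    ... | false | false | false with () ← trans (sym v) (bad-full j i c r)

    bad+column-part≤α : ∀ j i → bad j i + column-part j i ≤ 𝟙 (α j i)
    bad+column-part≤α j i with good-column j in c | good-row i in r | α j i in v
    ... | true  | _     | true  = ≤-refl
    ... | true  | _     | false = ≤-refl
    ... | false | true  | _     = z≤n
    ... | false | false | true  = ≤-refl
    ... | false | false | false with () ← trans (sym v) (bad-full j i c r)

    -- Here a chosen cell where a good row meets a good column is charged twice; the product on the
    -- right pays for the second charge.
    bad+row-part+column-part≤α : ∀ j i →
      bad j i + row-part j i + column-part j i ≤ 𝟙 (α j i) + 𝟙 (good-column j) * 𝟙 (good-row i)
    bad+row-part+column-part≤α j i with good-column j in c | good-row i in r | α j i in v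
    ... | true  | true  | true  = ≤-refl
    ... | true  | true  | false = z≤n
    ... | true  | false | true  = ≤-refl
    ... | true  | false | false = ≤-refl
    ... | false | true  | true  = ≤-refl
    ... | false | true  | false = ≤-refl
    ... | false | false | true  = ≤-refl
    ... | false | false | false with () ← trans (sym v) (bad-full j i c r)

    row-bound : (m ∸ X) * (n ∸ Y) + a * X ≤ total α
    row-bound = begin
      (m ∸ X) * (n ∸ Y) + a * X                     ≤⟨ +-mono-≤ (≤-reflexive (sym ∑bad)) ∑row-part ⟩
      _                                             ≡⟨ ∑∑-distrib-+ bad row-part ⟨
      ∑[ j < n ] ∑[ i < m ] (bad j i + row-part j i) ≤⟨ ∑∑-mono bad+row-part≤α ⟩
      total α                                       ∎
      where open ≤-Reasoning

    column-bound : (m ∸ X) * (n ∸ Y) + b * Y ≤ total α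
    column-bound = begin
      (m ∸ X) * (n ∸ Y) + b * Y                        ≤⟨ +-mono-≤ (≤-reflexive (sym ∑bad)) ∑column-part ⟩
      _                                                ≡⟨ ∑∑-distrib-+ bad column-part ⟨
      ∑[ j < n ] ∑[ i < m ] (bad j i + column-part j i) ≤⟨ ∑∑-mono bad+column-part≤α ⟩
      total α                                          ∎
      where open ≤-Reasoning

    joint-bound : (m ∸ X) * (n ∸ Y) + a * X + b * Y ≤ total α + Y * X
    joint-bound = begin
      (m ∸ X) * (n ∸ Y) + a * X + b * Y
        ≤⟨ +-mono-≤ (+-mono-≤ (≤-reflexive (sym ∑bad)) ∑row-part) ∑column-part ⟩
      _ ≡⟨ cong (_+ ∑[ j < n ] ∑[ i < m ] column-part j i) (∑∑-distrib-+ bad row-part) ⟨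
      _ ≡⟨ ∑∑-distrib-+ (λ j i → bad j i + row-part j i) column-part ⟨
      ∑[ j < n ] ∑[ i < m ] (bad j i + row-part j i + column-part j i)
        ≤⟨ ∑∑-mono bad+row-part+column-part≤α ⟩
      _ ≡⟨ ∑∑-distrib-+ (λ j i → 𝟙 (α j i)) (λ j i → 𝟙 (good-column j) * 𝟙 (good-row i)) ⟩
      _ ≡⟨ cong (total α +_) (∑∑-* (𝟙 ∘ good-column) (𝟙 ∘ good-row)) ⟩
      total α + Y * X ∎
      where open ≤-Reasoning

    sum-𝟙≤ : ∀ {k} (β : Fin k → Bool) → sum (𝟙 ∘ β) ≤ k
    sum-𝟙≤ {k} β = ≤-trans (sum-mono-≤ (𝟙≤1 ∘ β)) (≤-reflexive (trans (sum-const k 1) (*-identityʳ k)))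
      where
      𝟙≤1 : ∀ c → 𝟙 c ≤ 1
      𝟙≤1 true  = ≤-refl
      𝟙≤1 false = z≤n

  -- When both counts of good lines are too small, passing to (b , a) gains
  -- (b ∸ X) * (n ∸ a) + (a ∸ Y) * (m ∸ b) by the joint bound.
  ∃objective≤total : a ≤ n → b ≤ m →
    ∃₂ λ x y → (b ≤ x × x ≤ m) × (a ≤ y × y ≤ n) × objective a b m n x y ≤ total α
  ∃objective≤total a≤n b≤m with ≤-<-connex b X | ≤-<-connex a Y
  ... | inj₁ b≤X | inj₁ a≤Y = X , Y , (b≤X , sum-𝟙≤ good-row) , (a≤Y , sum-𝟙≤ good-column) , (begin
    (m ∸ X) * (n ∸ Y) + (a * X ⊔ b * Y)                       ≡⟨ +-distribˡ-⊔ ((m ∸ X) * (n ∸ Y)) _ _ ⟩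
    ((m ∸ X) * (n ∸ Y) + a * X) ⊔ ((m ∸ X) * (n ∸ Y) + b * Y) ≤⟨ ⊔-lub row-bound column-bound ⟩
    total α                                                   ∎)
    where open ≤-Reasoning
  -- Raising `X` to `b` shrinks the product, and the maximum is still `b * Y` because `a ≤ Y`. The
  -- next case is the mirror image.
  ... | inj₂ X<b | inj₁ a≤Y = b , Y , (≤-refl , b≤m) , (a≤Y , sum-𝟙≤ good-column) , (begin
    (m ∸ b) * (n ∸ Y) + (a * b ⊔ b * Y) ≡⟨ cong ((m ∸ b) * (n ∸ Y) +_) (m≤n⇒m⊔n≡n ab≤bY) ⟩
    (m ∸ b) * (n ∸ Y) + b * Y           ≤⟨ +-monoˡ-≤ _ (*-monoˡ-≤ (n ∸ Y) (∸-monoʳ-≤ m (<⇒≤ X<b))) ⟩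
    (m ∸ X) * (n ∸ Y) + b * Y           ≤⟨ column-bound ⟩
    total α                             ∎)
    where
    open ≤-Reasoning
    ab≤bY : a * b ≤ b * Y
    ab≤bY = ≤-trans (≤-reflexive (*-comm a b)) (*-monoʳ-≤ b a≤Y)
  ... | inj₁ b≤X | inj₂ Y<a = X , a , (b≤X , sum-𝟙≤ good-row) , (≤-refl , a≤n) , (begin
    (m ∸ X) * (n ∸ a) + (a * X ⊔ b * a) ≡⟨ cong ((m ∸ X) * (n ∸ a) +_) (m≥n⇒m⊔n≡m ba≤aX) ⟩
    (m ∸ X) * (n ∸ a) + a * X           ≤⟨ +-monoˡ-≤ _ (*-monoʳ-≤ (m ∸ X) (∸-monoʳ-≤ n (<⇒≤ Y<a))) ⟩
    (m ∸ X) * (n ∸ Y) + a * X           ≤⟨ row-bound ⟩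
    total α                             ∎)
    where
    open ≤-Reasoning
    ba≤aX : b * a ≤ a * X
    ba≤aX = ≤-trans (≤-reflexive (*-comm b a)) (*-monoʳ-≤ a b≤X)
  ... | inj₂ X<b | inj₂ Y<a = b , a , (≤-refl , b≤m) , (≤-refl , a≤n) , +-cancelʳ-≤ (Y * X) _ _ (begin
    (m ∸ b) * (n ∸ a) + (a * b ⊔ b * a) + Y * X
      ≡⟨ cong (λ t → (m ∸ b) * (n ∸ a) + t + Y * X) (trans (cong (_⊔ b * a) (*-comm a b)) (⊔-idem (b * a))) ⟩
    (m ∸ b) * (n ∸ a) + b * a + Y * X
      ≤⟨ corner (<⇒≤ X<b) (<⇒≤ Y<a) ⟩
    (m ∸ X) * (n ∸ Y) + a * X + b * Y ≤⟨ joint-bound ⟩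
    total α + Y * X                   ∎)
    where
    open ≤-Reasoning
    split : ∀ k {l u} → l ≤ u → u ≤ k → k ∸ l ≡ k ∸ u + (u ∸ l)
    split k {l} {u} l≤u u≤k = trans (cong (_∸ l) (sym (m∸n+n≡m u≤k))) (+-∸-assoc (k ∸ u) l≤u)
    expand : ∀ u v p q x y → (u + p) * (v + q) + (y + q) * x + (x + p) * y ≡
                             u * v + (x + p) * (y + q) + y * x + (p * v + u * q)
    expand = solve-∀
    corner : X ≤ b → Y ≤ a →
      (m ∸ b) * (n ∸ a) + b * a + Y * X ≤ (m ∸ X) * (n ∸ Y) + a * X + b * Y
    corner X≤b Y≤a = begin
      (m ∸ b) * (n ∸ a) + b * a + Y * X
        ≡⟨ cong₂ (λ s t → (m ∸ b) * (n ∸ a) + s * t + Y * X) (m+[n∸m]≡n X≤b) (m+[n∸m]≡n Y≤a) ⟨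
      (m ∸ b) * (n ∸ a) + (X + (b ∸ X)) * (Y + (a ∸ Y)) + Y * X
        ≤⟨ m≤m+n _ _ ⟩
      _ ≡⟨ expand (m ∸ b) (n ∸ a) (b ∸ X) (a ∸ Y) X Y ⟨
      (m ∸ b + (b ∸ X)) * (n ∸ a + (a ∸ Y)) + (Y + (a ∸ Y)) * X + (X + (b ∸ X)) * Y
        ≡⟨ cong₂ (λ s t → s + t * X + (X + (b ∸ X)) * Y)
             (cong₂ _*_ (split m X≤b b≤m) (split n Y≤a a≤n)) (sym (m+[n∸m]≡n Y≤a)) ⟨
      (m ∸ X) * (n ∸ Y) + a * X + (X + (b ∸ X)) * Y
        ≡⟨ cong (λ t → (m ∸ X) * (n ∸ Y) + a * X + t * Y) (m+[n∸m]≡n X≤b) ⟩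
      (m ∸ X) * (n ∸ Y) + a * X + b * Y ∎

-- The staircase construction

sum-toℕ-++ : ∀ k l (g : ℕ → ℕ) →
  ∑[ i < k + l ] g (toℕ i) ≡ ∑[ i < k ] g (toℕ i) + ∑[ i < l ] g (k + toℕ i)
sum-toℕ-++ zero    l g = refl
sum-toℕ-++ (suc k) l g = trans (cong (g 0 +_) (sum-toℕ-++ k l (g ∘ suc))) (sym (+-assoc (g 0) _ _))

sum-toℕ-snoc : ∀ k (g : ℕ → ℕ) → ∑[ i < suc k ] g (toℕ i) ≡ ∑[ i < k ] g (toℕ i) + g k
sum-toℕ-snoc zero    g = +-identityʳ (g 0)
sum-toℕ-snoc (suc k) g = trans (cong (g 0 +_) (sum-toℕ-snoc k (g ∘ suc))) (sym (+-assoc (g 0) _ _))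

sum-telescope : ∀ k (h c : ℕ → ℕ) → (∀ i → h i + c i ≡ h (suc i)) → h 0 + ∑[ i < k ] c (toℕ i) ≡ h k
sum-telescope zero    h c step = +-identityʳ (h 0)
sum-telescope (suc k) h c step = trans (sym (+-assoc (h 0) (c 0) _))
  (trans (cong (_+ ∑[ i < k ] c (suc (toℕ i))) (step 0)) (sum-telescope k (h ∘ suc) (c ∘ suc) (step ∘ suc)))

-- Hermite's identity. Raising `w` by one slides the window of `y` consecutive quotients by one
-- place: `w / y` leaves, and `(w + y) / y`, which is one larger, enters.
hermite : ∀ y w .{{_ : NonZero y}} → ∑[ e < y ] ((w + toℕ e) / y) ≡ w
hermite y zero    = sum-zero {y} (λ e → m<n⇒m/n≡0 (Fin.toℕ<n e))
hermite y (suc w) = +-cancelˡ-≡ (g 0) _ _ (begin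
  g 0 + ∑[ e < y ] ((suc w + toℕ e) / y)
    ≡⟨ cong (g 0 +_) (sum-cong-≗ {y} λ e → cong (_/ y) (+-suc w (toℕ e))) ⟨
  ∑[ e < suc y ] g (toℕ e)
    ≡⟨ sum-toℕ-snoc y g ⟩
  ∑[ e < y ] g (toℕ e) + g y
    ≡⟨ cong₂ _+_ (hermite y w)
         (trans (+-distrib-/-∣ʳ w ∣-refl) (cong₂ _+_ (cong (_/ y) (sym (+-identityʳ w))) (n/n≡1 y))) ⟩
  w + (g 0 + 1)
    ≡⟨ trans (cong (w +_) (+-comm (g 0) 1)) (+-suc w (g 0)) ⟩
  suc (w + g 0)
    ≡⟨ +-comm (suc w) (g 0) ⟩
  g 0 + suc w ∎)
  where
  open ≡-Reasoning
  open import Data.Nat.Divisibility using (∣-refl)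
  g : ℕ → ℕ
  g e = (w + e) / y

-- Filling the x × y block row by row, with a consecutive cells (cyclically) in
-- each row, makes its column counts differ by at most one: column e receives a
-- cell in row i exactly when ⌊(i a + e) / y⌋ jumps.
module _ (a x y m′ n′ : ℕ) .{{_ : NonZero y}} where

  private
    level : ℕ → ℕ → ℕ
    level e i = (i * a + e) / y

    jump : ℕ → ℕ → Bool
    jump e i = level e i <ᵇ level e (suc i)

    -- The first `x` rows and the first `y` columns are meant to be the good ones. Outside their
    -- block only the corner of bad rows and bad columns is filled.
    fill : ℕ → ℕ → Bool
    fill J I = if I <ᵇ x then (J <ᵇ y) ∧ jump J I else not (J <ᵇ y)

  staircase : Fin (y + n′) → Fin (x + m′) → Bool
  staircase j i = fill (toℕ j) (toℕ i)

  module _ (a≤y : a ≤ y) where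

    private
      -- One more row adds `a ≤ y` to the numerator, so the quotient grows by at most one and a
      -- Boolean records the whole increase.
      level-jump : ∀ e i → level e i + 𝟙 (jump e i) ≡ level e (suc i)
      level-jump e i with level e i <? level e (suc i)
      ... | yes up rewrite dec-true (level e i <? level e (suc i)) up =
        ≤-antisym (≤-trans (≤-reflexive (+-comm _ 1)) up) (begin
        (a + i * a + e) / y  ≤⟨ /-monoˡ-≤ y (begin
          a + i * a + e        ≡⟨ +-assoc a (i * a) e ⟩
          a + (i * a + e)      ≤⟨ +-monoˡ-≤ _ a≤y ⟩
          y + (i * a + e)      ≡⟨ +-comm y _ ⟩
          i * a + e + y        ∎) ⟩
        (i * a + e + y) / y  ≡⟨ trans (+-distrib-/-∣ʳ (i * a + e) ∣-refl) (cong (level e i +_) (n/n≡1 y)) ⟩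
        level e i + 1        ∎)
        where
        open ≤-Reasoning
        open import Data.Nat.Divisibility using (∣-refl)
      ... | no ¬up rewrite dec-false (level e i <? level e (suc i)) ¬up = trans (+-identityʳ _)
        (≤-antisym (/-monoˡ-≤ y (+-monoˡ-≤ e (m≤n+m (i * a) a))) (≮⇒≥ ¬up))

      -- By `hermite` the levels of all columns sum to `i * a` before the row and to `suc i * a`
      -- after it.
      row-jumps : ∀ i → ∑[ e < y ] 𝟙 (jump (toℕ e) i) ≡ a
      row-jumps i = +-cancelˡ-≡ (i * a) _ _ (begin
        i * a + ∑[ e < y ] 𝟙 (jump (toℕ e) i)
          ≡⟨ cong (_+ ∑[ e < y ] 𝟙 (jump (toℕ e) i)) (hermite y (i * a)) ⟨
        ∑[ e < y ] level (toℕ e) i + ∑[ e < y ] 𝟙 (jump (toℕ e) i)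
          ≡⟨ ∑-distrib-+ {y} (λ e → level (toℕ e) i) (λ e → 𝟙 (jump (toℕ e) i)) ⟨
        ∑[ e < y ] (level (toℕ e) i + 𝟙 (jump (toℕ e) i))
          ≡⟨ sum-cong-≗ {y} (λ e → level-jump (toℕ e) i) ⟩
        ∑[ e < y ] level (toℕ e) (suc i)
          ≡⟨ hermite y (suc i * a) ⟩
        a + i * a
          ≡⟨ +-comm a (i * a) ⟩
        i * a + a ∎)
        where open ≡-Reasoning

      row-inside : ∀ I → I < x → ∑[ j < y + n′ ] 𝟙 (fill (toℕ j) I) ≡ a
      row-inside I I<x rewrite dec-true (I <? x) I<x = trans (sum-toℕ-++ y n′ (λ J → 𝟙 ((J <ᵇ y) ∧ jump J I)))
        (trans (cong₂ _+_ (trans (sum-cong-≗ {y} left) (row-jumps I)) (sum-zero {n′} right)) (+-identityʳ a))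
        where
        left : ∀ (e : Fin y) → 𝟙 ((toℕ e <ᵇ y) ∧ jump (toℕ e) I) ≡ 𝟙 (jump (toℕ e) I)
        left e rewrite dec-true (toℕ e <? y) (Fin.toℕ<n e) = refl
        right : ∀ (k : Fin n′) → 𝟙 ((y + toℕ k <ᵇ y) ∧ jump (y + toℕ k) I) ≡ 0
        right k rewrite dec-false (y + toℕ k <? y) (m+n≮m y (toℕ k)) = refl

      row-outside : ∀ k → ∑[ j < y + n′ ] 𝟙 (fill (toℕ j) (x + k)) ≡ n′
      row-outside k rewrite dec-false (x + k <? x) (m+n≮m x k) = trans (sum-toℕ-++ y n′ (λ J → 𝟙 (not (J <ᵇ y))))
        (cong₂ _+_ (sum-zero {y} left) (trans (sum-cong-≗ {n′} right) (trans (sum-const n′ 1) (*-identityʳ n′))))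
        where
        left : ∀ (e : Fin y) → 𝟙 (not (toℕ e <ᵇ y)) ≡ 0
        left e rewrite dec-true (toℕ e <? y) (Fin.toℕ<n e) = refl
        right : ∀ (k : Fin n′) → 𝟙 (not (y + toℕ k <ᵇ y)) ≡ 1
        right k rewrite dec-false (y + toℕ k <? y) (m+n≮m y (toℕ k)) = refl

      -- The jumps in a column telescope from `J / y`, which is 0 since `J < y`, to its level after
      -- `x` rows.
      column-inside : ∀ J → J < y → (x * a) / y ≤ ∑[ i < x + m′ ] 𝟙 (fill J (toℕ i))
      column-inside J J<y = begin
        (x * a) / y                             ≤⟨ /-monoˡ-≤ y (m≤m+n (x * a) J) ⟩
        level J x                               ≡⟨ sum-telescope x (level J) (𝟙 ∘ jump J) (level-jump J) ⟨
        J / y + ∑[ i < x ] 𝟙 (jump J (toℕ i))   ≡⟨ cong (_+ ∑[ i < x ] 𝟙 (jump J (toℕ i))) (m<n⇒m/n≡0 J<y) ⟩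
        ∑[ i < x ] 𝟙 (jump J (toℕ i))           ≡⟨ sum-cong-≗ {x} above ⟩
        ∑[ i < x ] 𝟙 (fill J (toℕ i))           ≤⟨ m≤m+n _ _ ⟩
        _                                       ≡⟨ sum-toℕ-++ x m′ (𝟙 ∘ fill J) ⟨
        ∑[ i < x + m′ ] 𝟙 (fill J (toℕ i))      ∎
        where
        open ≤-Reasoning
        above : ∀ (i : Fin x) → 𝟙 (jump J (toℕ i)) ≡ 𝟙 (fill J (toℕ i))
        above i rewrite dec-true (toℕ i <? x) (Fin.toℕ<n i) | dec-true (J <? y) J<y = refl

    total-staircase : total staircase ≡ m′ * n′ + a * x
    total-staircase = begin
      total staircase
        ≡⟨ total≡∑rowCount staircase ⟩
      ∑[ i < x + m′ ] row (toℕ i)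
        ≡⟨ sum-toℕ-++ x m′ row ⟩
      ∑[ i < x ] row (toℕ i) + ∑[ k < m′ ] row (x + toℕ k)
        ≡⟨ cong₂ _+_ (sum-cong-≗ {x} λ i → row-inside (toℕ i) (Fin.toℕ<n i))
                    (sum-cong-≗ {m′} λ k → row-outside (toℕ k)) ⟩
      ∑[ _ < x ] a + ∑[ _ < m′ ] n′
        ≡⟨ cong₂ _+_ (trans (sum-const x a) (*-comm x a)) (sum-const m′ n′) ⟩
      a * x + m′ * n′
        ≡⟨ +-comm (a * x) (m′ * n′) ⟩
      m′ * n′ + a * x ∎
      where
      open ≡-Reasoning
      row : ℕ → ℕ
      row I = ∑[ j < y + n′ ] 𝟙 (fill (toℕ j) I)

    staircase-spanning : ∀ {b} → b * y ≤ a * x → Spanning staircase a b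
    staircase-spanning {b} by≤ax j i with toℕ i <? x | toℕ j <? y
    ... | yes i<x | _       = inj₂ (inj₁ (≤-reflexive (sym (row-inside (toℕ i) i<x))))
    ... | no  _   | yes j<y = inj₂ (inj₂ (≤-trans b≤ (column-inside (toℕ j) j<y)))
      where
      b≤ : b ≤ (x * a) / y
      b≤ = ≤-trans (≤-reflexive (sym (m*n/n≡m b y))) (/-monoˡ-≤ y (≤-trans by≤ax (≤-reflexive (*-comm a x))))
    ... | no  i≮x | no  j≮y rewrite dec-false (toℕ i <? x) i≮x | dec-false (toℕ j <? y) j≮y = inj₁ refl

∃spanning : ∀ {a b m n x y} .{{_ : NonZero a}} → x ≤ m → a ≤ y → y ≤ n → b * y ≤ a * x →
  ∃[ α ] Spanning {m} {n} α a b × total α ≡ (m ∸ x) * (n ∸ y) + a * x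
∃spanning {a} {x = x} {y} x≤m a≤y y≤n by≤ax
  with m′ , refl ← m≤n⇒∃[o]m+o≡n x≤m | n′ , refl ← m≤n⇒∃[o]m+o≡n y≤n
  rewrite m+n∸m≡n x m′ | m+n∸m≡n y n′ =
  staircase a x y m′ n′ {{y≢0}} , staircase-spanning a x y m′ n′ {{y≢0}} a≤y by≤ax ,
  total-staircase a x y m′ n′ {{y≢0}} a≤y
  where
  y≢0 : NonZero y
  y≢0 = >-nonZero (≤-trans (>-nonZero⁻¹ a) a≤y)

flip-spanning : ∀ {a b m n} {α : Fin n → Fin m → Bool} → Spanning α a b → Spanning (flip α) b a
flip-spanning spanning i j = Sum.map₂ Sum.swap (spanning j i)

module _ (a b m n : ℕ) .{{_ : NonZero a}} .{{_ : NonZero b}} where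

  γ≤objective : ∀ {x y} → b ≤ x → x ≤ m → a ≤ y → y ≤ n → γ (R a b) m n ≤ objective a b m n x y
  γ≤objective {x} {y} b≤x x≤m a≤y y≤n with ≤-total (b * y) (a * x)
  ... | inj₁ by≤ax with α , spanning , total≡ ← ∃spanning {b = b} x≤m a≤y y≤n by≤ax =
    ≤-trans (γ≤total α spanning) (≤-reflexive (trans total≡
      (cong ((m ∸ x) * (n ∸ y) +_) (sym (m≥n⇒m⊔n≡m by≤ax)))))
  -- The staircase puts `a * x` cells into its block, so if `b * y` is the larger product the roles
  -- of rows and columns are exchanged.
  ... | inj₂ ax≤by with α , spanning , total≡ ← ∃spanning {b = a} y≤n b≤x x≤m ax≤by =
    ≤-trans (γ≤total (flip α) (flip-spanning {α = α} spanning)) (≤-reflexive (begin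
      total (flip α)                      ≡⟨ total≡∑rowCount α ⟨
      total α                             ≡⟨ total≡ ⟩
      (n ∸ y) * (m ∸ x) + b * y           ≡⟨ cong₂ _+_ (*-comm (n ∸ y) (m ∸ x)) (sym (m≤n⇒m⊔n≡n ax≤by)) ⟩
      (m ∸ x) * (n ∸ y) + (a * x ⊔ b * y) ∎))
    where open ≡-Reasoning

  γ-minimum : a ≤ n → b ≤ m → γ (R a b) m n IsMinimumOf ObjectiveValue a b m n
  γ-minimum a≤n b≤m = attained , λ { _ (x , y , (b≤x , x≤m) , (a≤y , y≤n) , refl) → γ≤objective b≤x x≤m a≤y y≤n }
    where
    attained : ObjectiveValue a b m n (γ (R a b) m n)
    attained with γ-cells a b m n
    ... | α , spanning , total≡γ with ∃objective≤total α spanning a≤n b≤m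
    ...   | x , y , (b≤x , x≤m) , (a≤y , y≤n) , ≤total = x , y , (b≤x , x≤m) , (a≤y , y≤n) ,
      ≤-antisym (γ≤objective b≤x x≤m a≤y y≤n) (≤-trans ≤total (≤-reflexive total≡γ))

-- The square case

odd⇒1+2k : ∀ {a} → 2 ∤ a → ∃[ k ] a ≡ suc (k * 2)
odd⇒1+2k {a} 2∤a with a % 2 in eq | m%n<n a 2 | m≡m%n+[m/n]*n a 2
... | 0 | _ | _  = contradiction (m%n≡0⇒n∣m a 2 eq) 2∤a
... | 1 | _ | a≡ = a / 2 , a≡
... | suc (suc _) | s≤s (s≤s ()) | _

-- The objective at x = y = n ∸ v, for a = b and m = n.
diagonal : (a n v : ℕ) → ℕ
diagonal a n v = v * v + a * (n ∸ v)

-- Adding `a * v` cancels the truncated subtraction, so that two diagonal values can be compared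
-- over the naturals.
diagonal+av : ∀ a {n v} → v ≤ n → diagonal a n v + a * v ≡ v * v + a * n
diagonal+av a {n} {v} v≤n = trans (+-assoc (v * v) _ _)
  (cong (v * v +_) (trans (sym (*-distribˡ-+ a (n ∸ v) v)) (cong (a *_) (m∸n+n≡m v≤n))))

-- In integers, diagonal a n v ∸ diagonal a n u = (u ∸ v) * (a ∸ (u + v)).
diagonal-≤ : ∀ a {n u v} → u ≤ n → v ≤ n → (v ≤ u × u + v ≤ a) ⊎ (u ≤ v × a ≤ u + v) →
  diagonal a n u ≤ diagonal a n v
diagonal-≤ a {n} {u} {v} u≤n v≤n side = +-cancelʳ-≤ (a * u + a * v) _ _ (begin
  diagonal a n u + (a * u + a * v)  ≡⟨ regroup (diagonal a n u) (a * u) (a * v) ⟩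
  (diagonal a n u + a * u) + a * v  ≡⟨ cong (_+ a * v) (diagonal+av a u≤n) ⟩
  u * u + a * n + a * v             ≡⟨ swap (u * u) (a * n) (a * v) ⟩
  (u * u + a * v) + a * n           ≤⟨ +-monoˡ-≤ (a * n) (cross side) ⟩
  (v * v + a * u) + a * n           ≡⟨ swap (v * v) (a * u) (a * n) ⟩
  (v * v + a * n) + a * u           ≡⟨ cong (_+ a * u) (diagonal+av a v≤n) ⟨
  diagonal a n v + a * v + a * u    ≡⟨ regroup′ (diagonal a n v) (a * u) (a * v) ⟩
  diagonal a n v + (a * u + a * v)  ∎)
  where
  open ≤-Reasoning
  regroup : ∀ p q r → p + (q + r) ≡ (p + q) + r
  regroup = solve-∀
  regroup′ : ∀ p q r → p + r + q ≡ p + (q + r)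
  regroup′ = solve-∀
  swap : ∀ p q r → p + q + r ≡ p + r + q
  swap = solve-∀
  expand : ∀ v d a → (v + d) * (v + d) + a * v ≡ v * v + a * v + (v + d + v) * d
  expand = solve-∀
  collect : ∀ v d a → v * v + a * v + a * d ≡ v * v + a * (v + d)
  collect = solve-∀
  cross : (v ≤ u × u + v ≤ a) ⊎ (u ≤ v × a ≤ u + v) → u * u + a * v ≤ v * v + a * u
  cross (inj₁ (v≤u , u+v≤a)) with d , refl ← m≤n⇒∃[o]m+o≡n v≤u = begin
    (v + d) * (v + d) + a * v          ≡⟨ expand v d a ⟩
    v * v + a * v + (v + d + v) * d    ≤⟨ +-monoʳ-≤ (v * v + a * v) (*-monoˡ-≤ d u+v≤a) ⟩
    v * v + a * v + a * d              ≡⟨ collect v d a ⟩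
    v * v + a * (v + d)                ∎
  cross (inj₂ (u≤v , a≤u+v)) with d , refl ← m≤n⇒∃[o]m+o≡n u≤v = begin
    u * u + a * (u + d)                ≡⟨ collect u d a ⟨
    u * u + a * u + a * d              ≤⟨ +-monoʳ-≤ (u * u + a * u)
                                              (*-monoˡ-≤ d (≤-trans a≤u+v (≤-reflexive (+-comm u (u + d))))) ⟩
    u * u + a * u + (u + d + u) * d    ≡⟨ expand u d a ⟨
    (u + d) * (u + d) + a * u          ∎

-- Raising both coordinates to the larger one shrinks the product and leaves the maximum unchanged,
-- since both weights are `a`.
diagonal≤objective : ∀ a n {x y} → x ≤ n → y ≤ n → diagonal a n (n ∸ (x ⊔ y)) ≤ objective a a n n x y
diagonal≤objective a n {x} {y} x≤n y≤n = +-mono-≤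
  (*-mono-≤ (∸-monoʳ-≤ n (m≤m⊔n x y)) (∸-monoʳ-≤ n (m≤n⊔m x y)))
  (≤-reflexive (trans (cong (a *_) (m∸[m∸n]≡n (⊔-lub x≤n y≤n))) (*-distribˡ-⊔ a x y)))

module _ (a n : ℕ) .{{_ : NonZero a}} (a≤n : a ≤ n) where

  -- By `diagonal≤objective` only diagonal points compete, and the range `a ≤ x` turns into
  -- `v ≤ n ∸ a`. The last hypothesis is what `diagonal-≤` needs to compare `u` with each such `v`.
  γ-diagonal : ∀ {u} → u ≤ n ∸ a → (∀ {v} → v ≤ n ∸ a → (v ≤ u × u + v ≤ a) ⊎ (u ≤ v × a ≤ u + v)) →
    γ (R a a) n n ≡ diagonal a n u
  γ-diagonal {u} u≤ side with γ-minimum a a n n a≤n a≤n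
  ... | (x , y , (a≤x , x≤n) , (_ , y≤n) , γ≡) , least = ≤-antisym
    (≤-trans (γ≤objective a a n n a≤w (m∸n≤m n u) a≤w (m∸n≤m n u))
             (≤-reflexive (cong₂ _+_ (cong₂ _*_ w≡ w≡) (⊔-idem (a * (n ∸ u))))))
    (≤-trans (diagonal-≤ a u≤n (m∸n≤m n (x ⊔ y)) (side (∸-monoʳ-≤ n (≤-trans a≤x (m≤m⊔n x y)))))
             (≤-trans (diagonal≤objective a n x≤n y≤n) (≤-reflexive (sym γ≡))))
    where
    u≤n : u ≤ n
    u≤n = ≤-trans u≤ (m∸n≤m n a)
    w≡ : n ∸ (n ∸ u) ≡ u
    w≡ = m∸[m∸n]≡n u≤n
    a≤w : a ≤ n ∸ u
    a≤w = m+n≤o⇒m≤o∸n a (≤-trans (+-monoʳ-≤ a u≤) (≤-reflexive (m+[n∸m]≡n a≤n)))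

  -- The parabola `v * v + a * (n - v)` has its vertex at `a / 2`, and `3 * a ≤ 2 * n` says
  -- precisely that `a / 2 ≤ n - a`.
  γ-even : 2 ∣ a → 3 * a ≤ 2 * n → γ (R a a) n n ≡ a * n ∸ a ^ 2 / 4
  γ-even (divides u a≡2u) 3a≤2n = trans (γ-diagonal u≤n∸a (λ {v} _ → Sum.map
      (λ v≤u → v≤u , ≤-trans (+-monoʳ-≤ u v≤u) (≤-reflexive (sym a≡u+u)))
      (λ u≤v → u≤v , ≤-trans (≤-reflexive a≡u+u) (+-monoʳ-≤ u u≤v)) (≤-total v u)))
    (begin
      diagonal a n u                          ≡⟨ m+n∸n≡m _ (u * u) ⟨
      diagonal a n u + u * u ∸ u * u          ≡⟨ cong₂ _∸_ sum≡ (sym quarter) ⟩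
      a * n ∸ a ^ 2 / 4                       ∎)
    where
    open ≡-Reasoning
    2u≡u+u : ∀ u → u * 2 ≡ u + u
    2u≡u+u = solve-∀
    a≡u+u : a ≡ u + u
    a≡u+u = trans a≡2u (2u≡u+u u)
    triple : ∀ u → 3 * (u * 2) ≡ 2 * (u + u * 2)
    triple = solve-∀
    3u≤n : u + a ≤ n
    3u≤n = *-cancelˡ-≤ 2 (subst (_≤ 2 * n)
      (trans (cong (3 *_) a≡2u) (trans (triple u) (cong (λ t → 2 * (u + t)) (sym a≡2u)))) 3a≤2n)
    u≤n∸a : u ≤ n ∸ a
    u≤n∸a = m+n≤o⇒m≤o∸n u 3u≤n
    square : ∀ u → u * 2 * (u * 2 * 1) ≡ u * u * 4
    square = solve-∀
    quarter : a ^ 2 / 4 ≡ u * u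
    quarter = trans (cong (_/ 4) (trans (cong (_^ 2) a≡2u) (square u))) (m*n/n≡m (u * u) 4)
    shuffle : ∀ u t → u * u + t + u * u ≡ t + (u + u) * u
    shuffle = solve-∀
    sum≡ : diagonal a n u + u * u ≡ a * n
    sum≡ = trans (shuffle u (a * (n ∸ u))) (trans (cong (λ t → a * (n ∸ u) + t * u) (sym a≡u+u))
      (trans (sym (*-distribˡ-+ a (n ∸ u) u)) (cong (a *_) (m∸n+n≡m (≤-trans (m≤m+n u a) 3u≤n)))))

  -- For `a = 2 u + 1` the vertex lies halfway between `u` and `u + 1`, which tie. The smaller one
  -- is admissible for slightly larger `a`, hence the extra 1 in the condition.
  γ-odd : 2 ∤ a → 3 * a ≤ 2 * n + 1 → γ (R a a) n n ≡ a * n ∸ (a ^ 2 ∸ 1) / 4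
  γ-odd 2∤a 3a≤2n+1 with u , a≡1+2u ← odd⇒1+2k 2∤a = odd u a≡1+2u
    where
    odd : ∀ u → a ≡ suc (u * 2) → γ (R a a) n n ≡ a * n ∸ (a ^ 2 ∸ 1) / 4
    odd u a≡1+2u = trans (γ-diagonal u≤n∸a (λ {v} _ → Sum.map
        (λ v≤u → v≤u , ≤-trans (+-monoʳ-≤ u v≤u) (≤-trans (n≤1+n _) (≤-reflexive (sym a≡1+u+u))))
        (λ u<v → <⇒≤ u<v , ≤-trans (≤-reflexive (trans a≡1+u+u (sym (+-suc u u))))
                              (+-monoʳ-≤ u u<v)) (≤-<-connex v u)))
      (begin
        diagonal a n u                                ≡⟨ m+n∸n≡m _ (u * suc u) ⟨
        diagonal a n u + u * suc u ∸ u * suc u        ≡⟨ cong₂ _∸_ sum≡ (sym quarter) ⟩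
        a * n ∸ (a ^ 2 ∸ 1) / 4                       ∎)
      where
      open ≡-Reasoning
      1+2u≡1+u+u : ∀ u → 1 + u * 2 ≡ 1 + (u + u)
      1+2u≡1+u+u = solve-∀
      a≡1+u+u : a ≡ suc (u + u)
      a≡1+u+u = trans a≡1+2u (1+2u≡1+u+u u)
      triple : ∀ u → 3 * (1 + u * 2) ≡ 1 + 2 * (u + (1 + u * 2))
      triple = solve-∀
      3u<n : u + a ≤ n
      3u<n = *-cancelˡ-≤ 2 (s≤s⁻¹ (subst₂ _≤_
        (trans (cong (3 *_) a≡1+2u) (trans (triple u) (cong (λ t → suc (2 * (u + t))) (sym a≡1+2u))))
        (+-comm (2 * n) 1) 3a≤2n+1))
      u≤n∸a : u ≤ n ∸ a
      u≤n∸a = m+n≤o⇒m≤o∸n u 3u<n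
      square : ∀ u → (1 + u * 2) * ((1 + u * 2) * 1) ≡ 1 + u * (1 + u) * 4
      square = solve-∀
      quarter : (a ^ 2 ∸ 1) / 4 ≡ u * suc u
      quarter = trans (cong (λ t → (t ∸ 1) / 4) (trans (cong (_^ 2) a≡1+2u) (square u))) (m*n/n≡m (u * suc u) 4)
      shuffle : ∀ u t → u * u + t + u * (1 + u) ≡ t + (1 + (u + u)) * u
      shuffle = solve-∀
      sum≡ : diagonal a n u + u * suc u ≡ a * n
      sum≡ = trans (shuffle u (a * (n ∸ u))) (trans (cong (λ t → a * (n ∸ u) + t * u) (sym a≡1+u+u))
        (trans (sym (*-distribˡ-+ a (n ∸ u) u)) (cong (a *_) (m∸n+n≡m (≤-trans (m≤m+n u a) 3u<n)))))

  -- All admissible `v` now lie to the left of the vertex, so the last one, `n ∸ a`, is the best.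
  γ-otherwise : ¬ (2 ∣ a × 3 * a ≤ 2 * n) → ¬ (2 ∤ a × 3 * a ≤ 2 * n + 1) →
    γ (R a a) n n ≡ a ^ 2 + (n ∸ a) ^ 2
  γ-otherwise ¬even ¬odd = trans (γ-diagonal ≤-refl λ {v} v≤u →
      inj₁ (v≤u , ≤-trans (+-monoʳ-≤ (n ∸ a) v≤u) 2[n∸a]≤a))
    (begin
      (n ∸ a) * (n ∸ a) + a * (n ∸ (n ∸ a))  ≡⟨ cong (λ t → (n ∸ a) * (n ∸ a) + a * t) (m∸[m∸n]≡n a≤n) ⟩
      (n ∸ a) * (n ∸ a) + a * a              ≡⟨ squares a (n ∸ a) ⟩
      a ^ 2 + (n ∸ a) ^ 2                    ∎)
    where
    open ≡-Reasoning
    squares : ∀ a u → u * u + a * a ≡ a * (a * 1) + u * (u * 1)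
    squares = solve-∀
    2n<3a : 2 * n < 3 * a
    -- If `3 * a ≤ 2 * n`, then `¬even` makes `a` odd, and the weaker inequality of the odd case
    -- holds too.
    2n<3a = ≰⇒> λ 3a≤2n → ¬odd ((λ 2∣a → ¬even (2∣a , 3a≤2n)) , ≤-trans 3a≤2n (m≤m+n _ 1))
    expand : ∀ a u → 2 * (u + a) ≡ (u + u) + 2 * a
    expand = solve-∀
    expand′ : ∀ a → 3 * a ≡ a + 2 * a
    expand′ = solve-∀
    2[n∸a]≤a : n ∸ a + (n ∸ a) ≤ a
    2[n∸a]≤a = +-cancelʳ-≤ (2 * a) _ _ (subst₂ _≤_
      (trans (cong (2 *_) (sym (m∸n+n≡m a≤n))) (expand a (n ∸ a))) (expand′ a) (<⇒≤ 2n<3a))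

-- A calculus for loop-free programs

Assertion : Set₁
Assertion = Pred Store 0ℓ

Holds : Test → Assertion
Holds (e ≤ᵉ e′) s = eval e s ℤ.≤ eval e′ s
Holds (e =ᵉ e′) s = eval e s ≡ eval e′ s

holds? : ∀ c s → Dec (Holds c s)
holds? (e ≤ᵉ e′) s = eval e s ℤ.≤? eval e′ s
holds? (e =ᵉ e′) s = eval e s ℤ.≟ eval e′ s

test≡does : ∀ c s → test c s ≡ does (holds? c s)
test≡does (_ ≤ᵉ _) s = refl
test≡does (_ =ᵉ _) s = refl

test-true : ∀ c {s} → Holds c s → test c s ≡ true
test-true c {s} h = trans (test≡does c s) (dec-true (holds? c s) h)

test-false : ∀ c {s} → ¬ Holds c s → test c s ≡ false
test-false c {s} ¬h = trans (test≡does c s) (dec-false (holds? c s) ¬h)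

Halts : Program → Store → Assertion → ℕ → Set
Halts P s Q T = ∃₂ λ t s′ → (P , s ⇓[ t ] s′) × Q s′ × t ≤ T

halts-⨾ : ∀ {P P′ s Q Q′ T T′} → Halts P s Q T → (∀ s′ → Q s′ → Halts P′ s′ Q′ T′) →
          Halts (P ⨾ P′) s Q′ (T + T′)
halts-⨾ (_ , s′ , P⇓ , Qs′ , t≤T) rest with rest s′ Qs′
... | _ , s″ , P′⇓ , Q′s″ , t′≤T′ = _ , s″ , ⇓⨾ P⇓ P′⇓ , Q′s″ , +-mono-≤ t≤T t′≤T′

halts-mono : ∀ {P s Q Q′ T T′} → (∀ {s′} → Q s′ → Q′ s′) → T ≤ T′ → Halts P s Q T → Halts P s Q′ T′
halts-mono Q⇒Q′ T≤T′ (t , s′ , P⇓ , Qs′ , t≤T) = t , s′ , P⇓ , Q⇒Q′ Qs′ , ≤-trans t≤T T≤T′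

loopFree : Program → Bool
loopFree skip                   = true
loopFree (_ := _)               = true
loopFree (P ⨾ P′)               = loopFree P ∧ loopFree P′
loopFree (IF _ THEN P ELSE P′)  = loopFree P ∧ loopFree P′
loopFree (WHILE _ LOOP _)       = false

-- Worst-case cost and weakest precondition; the values at loops are junk, as
-- both are used for loop-free programs only.
worstCost : Program → ℕ
worstCost skip                  = 0
worstCost (_ := e)              = cost e
worstCost (P ⨾ P′)              = worstCost P + worstCost P′
worstCost (IF c THEN P ELSE P′) = testCost c + (worstCost P ⊔ worstCost P′)
worstCost (WHILE _ LOOP _)      = 0

wp : Program → Assertion → Assertion
wp skip                  Q s = Q s
wp (x := e)              Q s = Q (s [ x ↦ eval e s ])
wp (P ⨾ P′)              Q s = wp P (wp P′ Q) s
wp (IF c THEN P ELSE P′) Q s = (Holds c s → wp P Q s) × (¬ Holds c s → wp P′ Q s)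
wp (WHILE _ LOOP _)      Q s = Q s

wp-mono : ∀ P {Q Q′ : Assertion} → (∀ s → Q s → Q′ s) → ∀ s → wp P Q s → wp P Q′ s
wp-mono skip                  Q⇒Q′ s = Q⇒Q′ s
wp-mono (x := e)              Q⇒Q′ s = Q⇒Q′ _
wp-mono (P ⨾ P′)              Q⇒Q′ s = wp-mono P (wp-mono P′ Q⇒Q′) s
wp-mono (IF c THEN P ELSE P′) Q⇒Q′ s (t , e) = (λ h → wp-mono P Q⇒Q′ s (t h)) , (λ ¬h → wp-mono P′ Q⇒Q′ s (e ¬h))
wp-mono (WHILE _ LOOP _)      Q⇒Q′ s = Q⇒Q′ s

wp⇒halts : ∀ P {Q s} → T (loopFree P) → wp P Q s → Halts P s Q (worstCost P)
wp⇒halts skip     _ Qs = _ , _ , ⇓skip , Qs , ≤-refl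
wp⇒halts (x := e) _ Qs = _ , _ , ⇓:= , Qs , ≤-refl
wp⇒halts (P ⨾ P′) free pre with Equivalence.to T-∧ free
... | freeP , freeP′ = halts-⨾ (wp⇒halts P freeP pre) (λ s′ → wp⇒halts P′ freeP′)
wp⇒halts (IF c THEN P ELSE P′) {s = s} free (then , else) with Equivalence.to T-∧ free | holds? c s
... | freeP , _ | yes h with wp⇒halts P freeP (then h)
...   | t , s′ , P⇓ , Qs′ , t≤ = _ , s′ , ⇓then (test-true c h) P⇓ , Qs′ ,
  +-monoʳ-≤ (testCost c) (≤-trans t≤ (m≤m⊔n _ _))
wp⇒halts (IF c THEN P ELSE P′) {s = s} free (then , else) | _ , freeP′ | no ¬h with wp⇒halts P′ freeP′ (else ¬h)
...   | t , s′ , P′⇓ , Qs′ , t≤ = _ , s′ , ⇓else (test-false c ¬h) P′⇓ , Qs′ ,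
  +-monoʳ-≤ (testCost c) (≤-trans t≤ (m≤n⊔m _ _))

-- A record, because the unfolded precondition of a sequence of conditionals is
-- exponentially large.
record Ensures (P : Program) (Q : Assertion) (s : Store) : Set where
  constructor ensures
  field
    precondition : wp P Q s

open Ensures

ensures-⨾ : ∀ {P P′ Q Q′ s} → Ensures P Q s → (∀ s′ → Q s′ → Ensures P′ Q′ s′) → Ensures (P ⨾ P′) Q′ s
ensures-⨾ {P} first rest = ensures (wp-mono P (λ s′ Qs′ → precondition (rest s′ Qs′)) _ (precondition first))

ensures-mono : ∀ {P Q Q′ s} → (∀ s′ → Q s′ → Q′ s′) → Ensures P Q s → Ensures P Q′ s
ensures-mono {P} Q⇒Q′ first = ensures (wp-mono P Q⇒Q′ _ (precondition first))

ensures-:= : ∀ {x e P Q s} → Ensures P Q (s [ x ↦ eval e s ]) → Ensures (x := e ⨾ P) Q s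
ensures-:= rest = ensures (precondition rest)

ensures-halts : ∀ P {Q s} → T (loopFree P) → Ensures P Q s → Halts P s Q (worstCost P)
ensures-halts P free post = wp⇒halts P free (precondition post)

-- The invariant is indexed by the number `i` of iterations made, and the test can succeed only
-- while `i < N`. The fuel `k` covers the iterations left; the additional share in `suc k` pays for
-- the failing test.
while-halts : ∀ c P (I : ℕ → Assertion) N → T (loopFree P) →
  (∀ i {s} → I i s → Holds c s → i < N × Ensures P (I (suc i)) s) →
  ∀ k i {s} → N ≤ k + i → I i s →
  Halts (WHILE c LOOP P) s (λ s′ → ¬ Holds c s′ × ∃[ j ] I j s′) (suc k * (testCost c + worstCost P))
while-halts c P I N free step k i {s} N≤k+i Iis with holds? c s
... | no ¬h = _ , s , ⇓exit (test-false c ¬h) , (¬h , i , Iis) , ≤-trans (m≤m+n _ _) (m≤m+n _ _)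
... | yes h with step i Iis h
while-halts c P I N free step zero    i N≤i Iis | yes h | i<N , _ = contradiction i<N (≤⇒≯ N≤i)
while-halts c P I N free step (suc k) i N≤k+i Iis | yes h | i<N , body with ensures-halts P free body
... | t , s′ , P⇓ , Is′ , t≤ 
    with while-halts c P I N free step k (suc i) (≤-trans N≤k+i (≤-reflexive (sym (+-suc k i)))) Is′
...   | t′ , s″ , W⇓ , post , t′≤ = _ , s″ , ⇓again (test-true c h) P⇓ W⇓ , post ,
  +-mono-≤ (+-monoʳ-≤ (testCost c) t≤) t′≤

-- Minimising the objective

-- The ridge a x = b y separates the two branches of the maximum in the objective.
data Rounding : Set where
  down up : Rounding

round : Rounding → (a b y : ℕ) .{{_ : NonZero a}} → ℕ
round down a b y = b * y / a
round up   a b y = (b * y + (a ∸ 1)) / a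

module _ (a b m n : ℕ) .{{_ : NonZero a}} where

  round-down-≤ : ∀ y → a * round down a b y ≤ b * y
  round-down-≤ y = ≤-trans (≤-reflexive (*-comm a _)) (m/n*n≤m (b * y) a)

  ≤-round-up : ∀ y → b * y ≤ a * round up a b y
  ≤-round-up y = +-cancelʳ-≤ (a ∸ 1) _ _ (s≤s⁻¹ (begin-strict
    b * y + (a ∸ 1)                              ≡⟨ m≡m%n+[m/n]*n (b * y + (a ∸ 1)) a ⟩
    (b * y + (a ∸ 1)) % a + round up a b y * a   <⟨ +-monoˡ-< _ (m%n<n (b * y + (a ∸ 1)) a) ⟩
    a + round up a b y * a                       ≡⟨ +-comm a _ ⟩
    round up a b y * a + a                       ≡⟨ cong₂ _+_ (*-comm _ a) (sym (suc-pred a)) ⟩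
    a * round up a b y + suc (a ∸ 1)             ≡⟨ +-suc _ _ ⟩
    suc (a * round up a b y + (a ∸ 1))           ∎))
    where open ≤-Reasoning

  round-up-≤ : ∀ {x y} → b * y ≤ a * x → round up a b y ≤ x
  round-up-≤ {x} {y} by≤ax = s≤s⁻¹ (m<n*o⇒m/o<n (begin-strict
    b * y + (a ∸ 1)   <⟨ +-mono-≤-< by≤ax (≤-reflexive (suc-pred a)) ⟩
    a * x + a         ≡⟨ trans (+-comm (a * x) a) (cong (a +_) (*-comm a x)) ⟩
    suc x * a         ∎))
    where open ≤-Reasoning

  -- Since `a ≤ y` gives `b ≤ b * y / a`, a point next to the ridge can violate only the upper limit
  -- on `x`.
  round-≥ : ∀ ρ {y} → a ≤ y → b ≤ round ρ a b y
  round-≥ down {y} a≤y = ≤-trans (≤-reflexive (sym (m*n/n≡m b a))) (/-monoˡ-≤ a (*-monoʳ-≤ b a≤y))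
  round-≥ up   {y} a≤y = ≤-trans (round-≥ down a≤y) (/-monoˡ-≤ a (m≤m+n (b * y) (a ∸ 1)))

  -- The shift adds `b * p * t`, which equals `a * (q * t)`, to the numerator, and a multiple of `a`
  -- passes through the division.
  round-shift : ∀ ρ {p q} → a * q ≡ b * p → ∀ y t → round ρ a b (y + p * t) ≡ round ρ a b y + q * t
  round-shift ρ {p} {q} aq≡bp y t = shift ρ
    where
    move : ∀ b y p t c → b * (y + p * t) + c ≡ b * y + c + b * p * t
    move = solve-∀
    multiple : ∀ k → (k + b * p * t) / a ≡ k / a + q * t
    multiple k = begin
      (k + b * p * t) / a      ≡⟨ cong (λ l → (k + l * t) / a) aq≡bp ⟨
      (k + a * q * t) / a      ≡⟨ cong (λ l → (k + l) / a) (trans (*-assoc a q t) (*-comm a (q * t))) ⟩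
      (k + q * t * a) / a      ≡⟨ +-distrib-/-∣ʳ k (divides (q * t) refl) ⟩
      k / a + q * t * a / a    ≡⟨ cong (k / a +_) (m*n/n≡m (q * t) a) ⟩
      k / a + q * t            ∎
      where open ≡-Reasoning
    shift : ∀ ρ → round ρ a b (y + p * t) ≡ round ρ a b y + q * t
    shift down = trans
      (cong (_/ a) (trans (*-distribˡ-+ b y (p * t)) (cong (b * y +_) (sym (*-assoc b p t))))) (multiple (b * y))
    shift up   = trans (cong (_/ a) (move b y p t (a ∸ 1))) (multiple (b * y + (a ∸ 1)))

  -- For fixed y the objective decreases in x up to the ridge and is affine
  -- after it, so its minimum is next to the ridge or at x = m.
  next-to-ridge : ∀ {x y} → x ≤ m → y ≤ n →
    a * m ≤ objective a b m n x y ⊎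
    ∃[ ρ ] round ρ a b y ≤ m × objective a b m n (round ρ a b y) y ≤ objective a b m n x y
  next-to-ridge {x} {y} x≤m y≤n with ≤-total (a * x) (b * y)
  ... | inj₁ ax≤by with ≤-total m (round down a b y)
  ...   | inj₁ m≤x̂ = inj₁ (begin
    a * m                                 ≤⟨ *-monoʳ-≤ a m≤x̂ ⟩
    a * round down a b y                  ≤⟨ round-down-≤ y ⟩
    b * y                                 ≤⟨ m≤n⊔m (a * x) (b * y) ⟩
    a * x ⊔ b * y                         ≤⟨ m≤n+m _ _ ⟩
    objective a b m n x y                 ∎)
    where open ≤-Reasoning
  ...   | inj₂ x̂≤m = inj₂ (down , x̂≤m , +-mono-≤
    (*-monoˡ-≤ (n ∸ y) (∸-monoʳ-≤ m x≤x̂))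
    (≤-trans (≤-reflexive (m≤n⇒m⊔n≡n (round-down-≤ y))) (m≤n⊔m (a * x) (b * y))))
    where
    x≤x̂ : x ≤ round down a b y
    x≤x̂ = ≤-trans (≤-reflexive (sym (trans (cong (_/ a) (*-comm a x)) (m*n/n≡m x a)))) (/-monoˡ-≤ a ax≤by)
  -- Beyond the ridge the slope in `x` is `a - (n - y)`. If it is not positive, the objective is
  -- bounded below by its value at `x = m`; otherwise moving back to the ridge does not raise it.
  next-to-ridge {x} {y} x≤m y≤n | inj₂ by≤ax with ≤-total a (n ∸ y)
  ...   | inj₁ a≤n∸y = inj₁ (begin
    a * m                                 ≡⟨ trans (cong (_* a) (m∸n+n≡m x≤m)) (*-comm m a) ⟨
    (m ∸ x + x) * a                       ≡⟨ *-distribʳ-+ a (m ∸ x) x ⟩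
    (m ∸ x) * a + x * a                   ≤⟨ +-mono-≤ (*-monoʳ-≤ (m ∸ x) a≤n∸y) (≤-reflexive (*-comm x a)) ⟩
    (m ∸ x) * (n ∸ y) + a * x             ≤⟨ +-monoʳ-≤ ((m ∸ x) * (n ∸ y)) (m≤m⊔n (a * x) (b * y)) ⟩
    objective a b m n x y                 ∎)
    where open ≤-Reasoning
  ...   | inj₂ n∸y≤a = inj₂ (up , ≤-trans x̂≤x x≤m , (begin
    (m ∸ x̂) * (n ∸ y) + (a * x̂ ⊔ b * y)       ≡⟨ cong₂ _+_ (cong (_* (n ∸ y)) m∸x̂) (m≥n⇒m⊔n≡m (≤-round-up y)) ⟩
    (m ∸ x + (x ∸ x̂)) * (n ∸ y) + a * x̂       ≡⟨ expand (m ∸ x) (x ∸ x̂) (n ∸ y) (a * x̂) ⟩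
    (m ∸ x) * (n ∸ y) + ((x ∸ x̂) * (n ∸ y) + a * x̂)
      ≤⟨ +-monoʳ-≤ ((m ∸ x) * (n ∸ y)) (+-monoˡ-≤ (a * x̂) (*-monoʳ-≤ (x ∸ x̂) n∸y≤a)) ⟩
    (m ∸ x) * (n ∸ y) + ((x ∸ x̂) * a + a * x̂) ≡⟨ cong ((m ∸ x) * (n ∸ y) +_) ax ⟩
    (m ∸ x) * (n ∸ y) + a * x                 ≤⟨ +-monoʳ-≤ ((m ∸ x) * (n ∸ y)) (m≤m⊔n (a * x) (b * y)) ⟩
    objective a b m n x y                     ∎))
    where
    open ≤-Reasoning
    x̂ : ℕ
    x̂ = round up a b y
    x̂≤x : x̂ ≤ x
    x̂≤x = round-up-≤ by≤ax
    m∸x̂ : m ∸ x̂ ≡ m ∸ x + (x ∸ x̂)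
    m∸x̂ = trans (cong (_∸ x̂) (sym (m∸n+n≡m x≤m))) (+-∸-assoc (m ∸ x) x̂≤x)
    expand : ∀ u d v w → (u + d) * v + w ≡ u * v + (d * v + w)
    expand = solve-∀
    ax : (x ∸ x̂) * a + a * x̂ ≡ a * x
    ax = trans (cong (_+ a * x̂) (*-comm (x ∸ x̂) a))
      (trans (sym (*-distribˡ-+ a (x ∸ x̂) x̂)) (cong (a *_) (m∸n+n≡m x̂≤x)))

∸-gap : ∀ {k x d} e → x + e * d ≤ k → k ∸ x ≡ k ∸ (x + e * d) + e * d
∸-gap {k} {x} {d} e x+ed≤k = trans (cong (_∸ x) (sym (m∸n+n≡m x+ed≤k)))
  (trans (+-∸-assoc (k ∸ (x + e * d)) (m≤m+n x (e * d))) (cong (k ∸ (x + e * d) +_) (m+n∸m≡n x (e * d))))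

n≤n*n : ∀ n → n ≤ n * n
n≤n*n zero    = z≤n
n≤n*n (suc n) = m≤m*n (suc n) (suc n)

expand-square : ∀ u v p q d w → (u + q * d) * (v + p * d) + w ≡ u * v + w + ((u * p + v * q) * d + p * q * (d * d))
expand-square = solve-∀

-- Along a lattice direction (q , p) parallel to the ridge, the objective is a
-- convex quadratic with second difference 2 p q.
module Ridge (a b m n p q : ℕ) (aq≡bp : a * q ≡ b * p) where

  weight-shift : ∀ x y d → a * (x + q * d) ⊔ b * (y + p * d) ≡ (a * x ⊔ b * y) + a * q * d
  weight-shift x y d = begin
    a * (x + q * d) ⊔ b * (y + p * d)
      ≡⟨ cong₂ _⊔_ (distrib a x q d) (trans (distrib b y p d) (cong (λ l → b * y + l * d) (sym aq≡bp))) ⟩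
    (a * x + a * q * d) ⊔ (b * y + a * q * d)
      ≡⟨ +-distribʳ-⊔ (a * q * d) (a * x) (b * y) ⟨
    (a * x ⊔ b * y) + a * q * d ∎
    where
    open ≡-Reasoning
    distrib : ∀ a x q d → a * (x + q * d) ≡ a * x + a * q * d
    distrib = solve-∀

  -- The inequality on `a * q` says that the last unit step does not raise the objective; by
  -- convexity no earlier one does. Convexity enters as `d ≤ d * d`.
  forward-≤ : ∀ {x y} d → x + q * d ≤ m → y + p * d ≤ n →
    a * q ≤ (m ∸ (x + q * d)) * p + (n ∸ (y + p * d)) * q + p * q →
    objective a b m n (x + q * d) (y + p * d) ≤ objective a b m n x y
  forward-≤ {x} {y} d x≤ y≤ slope = begin
    u * v + (a * (x + q * d) ⊔ b * (y + p * d))       ≡⟨ cong (u * v +_) (weight-shift x y d) ⟩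
    u * v + (w + a * q * d)                           ≡⟨ +-assoc (u * v) w _ ⟨
    u * v + w + a * q * d                             ≤⟨ +-monoʳ-≤ (u * v + w) (begin
      a * q * d                                         ≤⟨ *-monoˡ-≤ d slope ⟩
      (u * p + v * q + p * q) * d                       ≡⟨ *-distribʳ-+ d (u * p + v * q) (p * q) ⟩
      (u * p + v * q) * d + p * q * d                   ≤⟨ +-monoʳ-≤ ((u * p + v * q) * d) (*-monoʳ-≤ (p * q) (n≤n*n d)) ⟩
      (u * p + v * q) * d + p * q * (d * d)             ∎) ⟩
    u * v + w + ((u * p + v * q) * d + p * q * (d * d)) ≡⟨ expand-square u v p q d w ⟨
    (u + q * d) * (v + p * d) + w                     ≡⟨ cong₂ (λ s t → s * t + w) (∸-gap q x≤) (∸-gap p y≤) ⟨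
    objective a b m n x y                             ∎
    where
    open ≤-Reasoning
    u v w : ℕ
    u = m ∸ (x + q * d)
    v = n ∸ (y + p * d)
    w = a * x ⊔ b * y

  -- The mirror image: here the first unit step does not lower the objective, so no later one does.
  backward-≤ : ∀ {x y} d → x + q * d ≤ m → y + p * d ≤ n →
    (m ∸ x) * p + (n ∸ y) * q ≤ a * q + p * q →
    objective a b m n x y ≤ objective a b m n (x + q * d) (y + p * d)
  backward-≤ {x} {y} d x≤ y≤ slope = begin
    objective a b m n x y                             ≡⟨ cong₂ (λ s t → s * t + w) (∸-gap q x≤) (∸-gap p y≤) ⟩
    (u + q * d) * (v + p * d) + w                     ≡⟨ expand-square u v p q d w ⟩
    u * v + w + ((u * p + v * q) * d + p * q * (d * d)) ≤⟨ +-monoʳ-≤ (u * v + w) (+-cancelʳ-≤ (p * q * (d * d)) _ _ (begin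
      (u * p + v * q) * d + p * q * (d * d) + p * q * (d * d) ≡⟨ collect u v p q d ⟩
      ((u + q * d) * p + (v + p * d) * q) * d           ≡⟨ cong₂ (λ s t → (s * p + t * q) * d) (∸-gap q x≤) (∸-gap p y≤) ⟨
      ((m ∸ x) * p + (n ∸ y) * q) * d                   ≤⟨ *-monoˡ-≤ d slope ⟩
      (a * q + p * q) * d                               ≡⟨ *-distribʳ-+ d (a * q) (p * q) ⟩
      a * q * d + p * q * d                             ≤⟨ +-monoʳ-≤ (a * q * d) (*-monoʳ-≤ (p * q) (n≤n*n d)) ⟩
      a * q * d + p * q * (d * d)                       ∎)) ⟩
    u * v + w + a * q * d                             ≡⟨ +-assoc (u * v) w _ ⟩
    u * v + (w + a * q * d)                           ≡⟨ cong (u * v +_) (weight-shift x y d) ⟨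
    u * v + (a * (x + q * d) ⊔ b * (y + p * d))       ∎
    where
    open ≤-Reasoning
    u v w : ℕ
    u = m ∸ (x + q * d)
    v = n ∸ (y + p * d)
    w = a * x ⊔ b * y
    collect : ∀ u v p q d → (u * p + v * q) * d + p * q * (d * d) + p * q * (d * d) ≡
                            ((u + q * d) * p + (v + p * d) * q) * d
    collect = solve-∀

  module _ (x₀ y₀ : ℕ) where

    private
      X Y : ℕ → ℕ
      X t = x₀ + q * t
      Y t = y₀ + p * t

    Valid : ℕ → Set
    Valid t = X t ≤ m × Y t ≤ n

    -- Signs of differences along the class: `Falling u` concerns the step from `u - 1` to `u`,
    -- `Rising u` the step from `u` to `u + 1`.
    Rising Falling : ℕ → Set
    Falling u = a * q ≤ (m ∸ X u) * p + (n ∸ Y u) * q + p * q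
    Rising  u = (m ∸ X u) * p + (n ∸ Y u) * q ≤ a * q + p * q

    private
      advance : ∀ x q t d → x + q * t + q * d ≡ x + q * (t + d)
      advance = solve-∀

    convex-≤ : ∀ {t u} → Valid t → Valid u → (t ≤ u × Falling u) ⊎ (u ≤ t × Rising u) →
      objective a b m n (X u) (Y u) ≤ objective a b m n (X t) (Y t)
    convex-≤ {t} _ (X≤m , Y≤n) (inj₁ (t≤u , falling)) with d , refl ← m≤n⇒∃[o]m+o≡n t≤u
      rewrite sym (advance x₀ q t d) | sym (advance y₀ p t d) = forward-≤ d X≤m Y≤n falling
    convex-≤ {t} {u} (X≤m , Y≤n) _ (inj₂ (u≤t , rising)) with d , refl ← m≤n⇒∃[o]m+o≡n u≤t
      rewrite sym (advance x₀ q u d) | sym (advance y₀ p u d) = backward-≤ d X≤m Y≤n rising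

    -- Both upper limits occur because the program tries each of them and discards points out of
    -- range, instead of computing the smaller limit.
    data Candidate (τ : ℤ) : ℕ → Set where
      first  : Candidate τ 0
      lastʸ  : .{{_ : NonZero p}} → Candidate τ ((n ∸ y₀) / p)
      lastˣ  : .{{_ : NonZero q}} → Candidate τ ((m ∸ x₀) / q)
      vertex : ∀ {u} → τ ≡ ℤ.+ u → Candidate τ u

    -- On the interval from 0 to the smaller upper limit, a convex sequence is least at its vertex
    -- clamped to that interval.
    best-candidate : .{{_ : NonZero p}} .{{_ : NonZero q}} → ∀ τ →
      (∀ {u} → Valid u → ℤ.+ u ℤ.≤ τ → Falling u) → (∀ {u} → Valid u → τ ℤ.≤ ℤ.+ u → Rising u) →
      ∀ {t} → Valid t →
      ∃[ u ] Candidate τ u × Valid u × objective a b m n (X u) (Y u) ≤ objective a b m n (X t) (Y t)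
    best-candidate -[1+ _ ] falling rising {t} valid@(X≤m , Y≤n) =
      0 , first , valid₀ , convex-≤ valid valid₀ (inj₂ (z≤n , rising valid₀ ℤ.-≤+))
      where
      valid₀ : Valid 0
      valid₀ = ≤-trans (+-monoʳ-≤ x₀ (*-monoʳ-≤ q z≤n)) X≤m , ≤-trans (+-monoʳ-≤ y₀ (*-monoʳ-≤ p z≤n)) Y≤n
    best-candidate (ℤ.+ v) falling rising {t} valid@(X≤m , Y≤n) =
      choose (≤-total v Tˣ) (≤-total v Tʸ) (≤-total Tˣ Tʸ)
      where
      Tˣ Tʸ : ℕ
      Tˣ = (m ∸ x₀) / q
      Tʸ = (n ∸ y₀) / p
      fits : ∀ {k x u} e .{{_ : NonZero e}} → x ≤ k → u ≤ (k ∸ x) / e → x + e * u ≤ k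
      fits {k} {x} e x≤k u≤ = ≤-trans
        (+-monoʳ-≤ x (≤-trans (*-monoʳ-≤ e u≤) (≤-trans (≤-reflexive (*-comm e _)) (m/n*n≤m (k ∸ x) e))))
        (≤-reflexive (m+[n∸m]≡n x≤k))
      fitted : ∀ {k x u} e .{{_ : NonZero e}} → x + e * u ≤ k → u ≤ (k ∸ x) / e
      fitted {k} {x} {u} e x+eu≤k = ≤-trans (≤-reflexive (sym (m*n/n≡m u e)))
        (/-monoˡ-≤ e (≤-trans (≤-reflexive (*-comm u e)) 
          (m+n≤o⇒m≤o∸n (e * u) (≤-trans (≤-reflexive (+-comm (e * u) x)) x+eu≤k))))
      valid⁺ : ∀ {u} → u ≤ Tˣ → u ≤ Tʸ → Valid u
      valid⁺ u≤Tˣ u≤Tʸ = fits q (m+n≤o⇒m≤o x₀ X≤m) u≤Tˣ , fits p (m+n≤o⇒m≤o y₀ Y≤n) u≤Tʸ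
      before : ∀ {u} → Candidate (ℤ.+ v) u → Valid u → t ≤ u → u ≤ v →
        ∃[ u ] Candidate (ℤ.+ v) u × Valid u × objective a b m n (X u) (Y u) ≤ objective a b m n (X t) (Y t)
      before c validᵤ t≤u u≤v = _ , c , validᵤ , convex-≤ valid validᵤ (inj₁ (t≤u , falling validᵤ (ℤ.+≤+ u≤v)))
      choose : v ≤ Tˣ ⊎ Tˣ ≤ v → v ≤ Tʸ ⊎ Tʸ ≤ v → Tˣ ≤ Tʸ ⊎ Tʸ ≤ Tˣ →
        ∃[ u ] Candidate (ℤ.+ v) u × Valid u × objective a b m n (X u) (Y u) ≤ objective a b m n (X t) (Y t)
      choose (inj₁ v≤Tˣ) (inj₁ v≤Tʸ) _ with ≤-total t v
      ... | inj₁ t≤v = before (vertex refl) (valid⁺ v≤Tˣ v≤Tʸ) t≤v ≤-refl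
      ... | inj₂ v≤t = v , vertex refl , validᵥ , convex-≤ valid validᵥ (inj₂ (v≤t , rising validᵥ ℤ.≤-refl))
        where
        validᵥ : Valid v
        validᵥ = valid⁺ v≤Tˣ v≤Tʸ
      choose (inj₁ v≤Tˣ) (inj₂ Tʸ≤v) _ = before lastʸ (valid⁺ (≤-trans Tʸ≤v v≤Tˣ) ≤-refl) (fitted p Y≤n) Tʸ≤v
      choose (inj₂ Tˣ≤v) (inj₁ v≤Tʸ) _ = before lastˣ (valid⁺ ≤-refl (≤-trans Tˣ≤v v≤Tʸ)) (fitted q X≤m) Tˣ≤v
      choose (inj₂ Tˣ≤v) (inj₂ _) (inj₁ Tˣ≤Tʸ) = before lastˣ (valid⁺ ≤-refl Tˣ≤Tʸ) (fitted q X≤m) Tˣ≤v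
      choose (inj₂ _) (inj₂ Tʸ≤v) (inj₂ Tʸ≤Tˣ) = before lastʸ (valid⁺ Tʸ≤Tˣ ≤-refl) (fitted p Y≤n) Tʸ≤v

-- The algorithm

-- Opened only here, as +_ makes sections such as (k +_) ambiguous.
open import Data.Integer.Base using (+_)

infixl 6 _⊕_ _⊖_
infixl 7 _⊗_ _⊘_

_⊕_ _⊖_ _⊗_ _⊘_ : Expr → Expr → Expr
e ⊕ e′ = e ⟨ add ⟩ e′
e ⊖ e′ = e ⟨ sub ⟩ e′
e ⊗ e′ = e ⟨ mul ⟩ e′
e ⊘ e′ = e ⟨ div ⟩ e′

infix 3 _IF_

_IF_ : Program → Test → Program
P IF c = IF c THEN P ELSE skip

va vb vm vn vp vq vbest vr vx₀ vy₀ vt vx vy vw vv : Var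
va    = 0
vb    = 1
vm    = 2
vn    = 3
vp    = 4
vq    = 5
vbest = 6
vr    = 7
vx₀   = 8
vy₀   = 9
vt    = 10
vx    = 11
vy    = 12
vw    = 13
vv    = 14

-- Along the class of (x₀ , y₀) the objective is p q t² - K t plus a constant, with
-- K = (m - x₀) p + (n - y₀) q - a q, so ⌊(K + p q) / (2 p q)⌋ is a minimiser over ℤ.
vertexExpr : Expr
vertexExpr = ((` vm ⊖ ` vx₀) ⊗ ` vp ⊕ (` vn ⊖ ` vy₀) ⊗ ` vq ⊕ ` vp ⊗ ` vq ⊖ ` va ⊗ ` vq)
             ⊘ (# (+ 2) ⊗ (` vp ⊗ ` vq))

-- The guards in `try` admit only points in range, where integer subtraction agrees with the
-- truncated one and the value computed is an objective value.
raiseWeight lowerBest update try : Program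
raiseWeight = vw := ` vb ⊗ ` vy IF ` vw ≤ᵉ ` vb ⊗ ` vy
lowerBest   = vbest := ` vv IF ` vv ≤ᵉ ` vbest
update = vw := ` va ⊗ ` vx ⨾ raiseWeight ⨾
         vv := (` vm ⊖ ` vx) ⊗ (` vn ⊖ ` vy) ⊕ ` vw ⨾ lowerBest
try = (((update IF ` vy ≤ᵉ ` vn) IF ` va ≤ᵉ ` vy) IF ` vx ≤ᵉ ` vm) IF ` vb ≤ᵉ ` vx

candidate : Expr → Program
candidate e = vt := e ⨾ vx := ` vx₀ ⊕ ` vq ⊗ ` vt ⨾ vy := ` vy₀ ⊕ ` vp ⊗ ` vt ⨾ try

family body : Program
family = candidate (# (+ 0)) ⨾ candidate ((` vn ⊖ ` vy₀) ⊘ ` vp) ⨾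
         candidate ((` vm ⊖ ` vx₀) ⊘ ` vq) ⨾ candidate vertexExpr
body = vy₀ := ` va ⊕ ` vr ⨾
       vx₀ := (` vb ⊗ ` vy₀) ⊘ ` va ⨾ family ⨾
       vx₀ := (` vb ⊗ ` vy₀ ⊕ (` va ⊖ # (+ 1))) ⊘ ` va ⨾ family ⨾
       vr := ` vr ⊕ # (+ 1)

-- The search stops at the least p ≥ 1 with a ∣ b p, that is, at a / gcd a b.
searchTest : Test
searchTest = # (+ 1) ≤ᵉ ` vb ⊗ ` vp ⊖ ` va ⊗ ((` vb ⊗ ` vp) ⊘ ` va)

searchStep : Program
searchStep = vp := ` vp ⊕ # (+ 1)

-- `swap` transposes the problem: it exchanges `a` with `b` and `m` with `n`. It uses `vp` as
-- scratch space, so `vp` receives its starting value 1 only after the conditional.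
swap setup search init residues algorithm : Program
swap = vp := ` va ⨾ va := ` vb ⨾ vb := ` vp ⨾ vp := ` vm ⨾ vm := ` vn ⨾ vn := ` vp
setup = IF ` va ≤ᵉ ` vb THEN skip ELSE swap ⨾ vp := # (+ 1)
search = WHILE searchTest LOOP searchStep
init = vq := (` vb ⊗ ` vp) ⊘ ` va ⨾ vbest := ` va ⊗ ` vm ⨾ vr := # (+ 0)
residues = WHILE ` vr ⊕ # (+ 1) ≤ᵉ ` vp LOOP body
algorithm = setup ⨾ search ⨾ init ⨾ residues ⨾ va := ` vbest

-- Natural-number values of integer expressions

private
  variable
    i j : ℤ
    k l : ℕ

+-value : i ≡ + k → j ≡ + l → i ℤ.+ j ≡ + (k + l)
+-value refl refl = refl

*-value : i ≡ + k → j ≡ + l → i ℤ.* j ≡ + (k * l)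
*-value {k = k} {l = l} refl refl = sym (ℤ.pos-* k l)

∸-value : l ≤ k → i ≡ + k → j ≡ + l → i ℤ.- j ≡ + (k ∸ l)
∸-value {l} {k} l≤k refl refl = trans (ℤ.m-n≡m⊖n k l) (ℤ.⊖-≥ l≤k)

÷-value : ∀ {k} .{{_ : NonZero l}} → i ≡ + k → j ≡ + l → i ÷ j ≡ + (k / l)
÷-value {suc l} {k = k} refl refl = ℤ.div-pos-is-/ℕ (+ k) (suc l)

÷-lower : ∀ i l .{{_ : NonZero l}} → (i ÷ (+ l)) ℤ.* + l ℤ.≤ i
÷-lower i (suc l) = ℤ.[n/d]*d≤n i (+ suc l)

÷-upper : ∀ i l .{{_ : NonZero l}} → i ℤ.< ℤ.suc (i ÷ (+ l)) ℤ.* + l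
÷-upper i (suc l) = subst (λ t → i ℤ.< ℤ.suc t ℤ.* + suc l)
  (sym (ℤ.div-pos-is-/ℕ i (suc l))) (ℤ.n<s[n/ℕd]*d i (suc l))

≤-value : i ≡ + k → j ≡ + l → k ≤ l → i ℤ.≤ j
≤-value refl refl = ℤ.+≤+

≤-value⁻ : i ≡ + k → j ≡ + l → i ℤ.≤ j → k ≤ l
≤-value⁻ refl refl = ℤ.drop‿+≤+

minus-plus : ∀ i j → i ℤ.- j ℤ.+ j ≡ i
minus-plus = ℤ-solve-∀

-- The numerator of the vertex may be negative. This lemma and the next turn comparisons with its
-- floor into inequalities of naturals without subtraction.
÷-≥ : ∀ {k l d u} .{{_ : NonZero d}} → + u ℤ.≤ (+ k ℤ.- + l) ÷ (+ d) → u * d + l ≤ k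
÷-≥ {k} {l} {d} {u} u≤ = ≤-value⁻ (+-value (*-value {k = u} {l = d} refl refl) refl) (minus-plus (+ k) (+ l))
  (ℤ.+-monoˡ-≤ (+ l) (ℤ.≤-trans (ℤ.*-monoʳ-≤-nonNeg (+ d) u≤) (÷-lower (+ k ℤ.- + l) d)))

÷-≤ : ∀ {k l d u} .{{_ : NonZero d}} → (+ k ℤ.- + l) ÷ (+ d) ℤ.≤ + u → k < suc u * d + l
÷-≤ {k} {l} {d} {u} ≤u = ℤ.drop‿+<+ (subst₂ ℤ._<_
  (minus-plus (+ k) (+ l)) (+-value (*-value {k = suc u} {l = d} refl refl) refl)
  (ℤ.+-monoˡ-< (+ l) (ℤ.<-≤-trans (÷-upper (+ k ℤ.- + l) d) (ℤ.*-monoʳ-≤-nonNeg (+ d) (ℤ.suc-mono ≤u)))))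

≥-natural : i ≡ + k → i ℤ.≤ j → ∃[ l ] j ≡ + l
≥-natural refl (ℤ.+≤+ {n = l} _) = l , refl

-- Correctness of the scan over the residue classes

module _ (a b m n : ℕ) where

  InRange : ℕ → ℕ → Set
  InRange x y = (b ≤ x × x ≤ m) × (a ≤ y × y ≤ n)

  Inputs : Assertion
  Inputs s = s va ≡ + a × s vb ≡ + b × s vm ≡ + m × s vn ≡ + n

module Search (a b m n p q : ℕ) where

  -- That `β` is an objective value is part of the invariant, so at the end only its minimality is
  -- left to prove.
  Searching : ℕ → ℕ → Assertion
  Searching r β s = Inputs a b m n s × s vp ≡ + p × s vq ≡ + q × s vr ≡ + r ×
                    s vbest ≡ + β × ObjectiveValue a b m n β

  Anchored : (r x₀ y₀ β : ℕ) → Assertion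
  Anchored r x₀ y₀ β s = Searching r β s × s vx₀ ≡ + x₀ × s vy₀ ≡ + y₀

  -- The clause `β′ ≤ β` lets what earlier candidates have established about `β` survive later
  -- updates.
  Improved : (ℕ → Assertion) → ℕ → (ℕ → Set) → Assertion
  Improved S β C s = ∃[ β′ ] S β′ s × β′ ≤ β × C β′

  module _ {r x₀ y₀ : ℕ} where

    private
      A : ℕ → Assertion
      A = Anchored r x₀ y₀

    lowerBest-wp : ∀ s {β x y} → InRange a b m n x y → A β s → s vv ≡ + objective a b m n x y →
      wp lowerBest (Improved A β (_≤ objective a b m n x y)) s
    lowerBest-wp s {x = x} {y} (x∈ , y∈) (((inputs , p≡ , q≡ , r≡ , β≡ , attained) , x₀≡ , y₀≡)) v≡ =
      (λ v≤best → _ , ((inputs , p≡ , q≡ , r≡ , v≡ , (x , y , x∈ , y∈ , refl)) , x₀≡ , y₀≡) ,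
                  ≤-value⁻ v≡ β≡ v≤best , ≤-refl) ,
      (λ v≰best → _ , ((inputs , p≡ , q≡ , r≡ , β≡ , attained) , x₀≡ , y₀≡) , ≤-refl ,
                  <⇒≤ (≰⇒> (v≰best ∘ ≤-value v≡ β≡)))

    update-wp : ∀ s {β x y} → InRange a b m n x y → A β s → s vx ≡ + x → s vy ≡ + y →
      wp update (Improved A β (_≤ objective a b m n x y)) s
    update-wp s {β} {x} {y} range@((_ , x≤m) , (_ , y≤n)) anchored@(((a≡ , b≡ , m≡ , n≡) , _) , _) x≡ y≡ =
      (λ ax≤by → lowerBest-wp (evaluate (s₁ [ vw ↦ s vb ℤ.* s vy ])) range anchored
                   (value (≤-value⁻ ax≡ by≡ ax≤by) by≡)) ,
      (λ ax≰by → lowerBest-wp (evaluate s₁) range anchored (value′ (ax≰by ∘ ≤-value ax≡ by≡) ax≡))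
      where
      s₁ : Store
      s₁ = s [ vw ↦ s va ℤ.* s vx ]
      evaluate : Store → Store
      evaluate s = s [ vv ↦ (s vm ℤ.- s vx) ℤ.* (s vn ℤ.- s vy) ℤ.+ s vw ]
      ax≡ : s va ℤ.* s vx ≡ + (a * x)
      ax≡ = *-value a≡ x≡
      by≡ : s vb ℤ.* s vy ≡ + (b * y)
      by≡ = *-value b≡ y≡
      rectangle : (s vm ℤ.- s vx) ℤ.* (s vn ℤ.- s vy) ≡ + ((m ∸ x) * (n ∸ y))
      rectangle = *-value (∸-value x≤m m≡ x≡) (∸-value y≤n n≡ y≡)
      value : ∀ {w} → a * x ≤ b * y → w ≡ + (b * y) →
        (s vm ℤ.- s vx) ℤ.* (s vn ℤ.- s vy) ℤ.+ w ≡ + objective a b m n x y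
      value ax≤by w≡ = +-value rectangle (trans w≡ (cong +_ (sym (m≤n⇒m⊔n≡n ax≤by))))
      value′ : ∀ {w} → ¬ a * x ≤ b * y → w ≡ + (a * x) →
        (s vm ℤ.- s vx) ℤ.* (s vn ℤ.- s vy) ℤ.+ w ≡ + objective a b m n x y
      value′ ax≰by w≡ = +-value rectangle (trans w≡ (cong +_ (sym (m≥n⇒m⊔n≡m (<⇒≤ (≰⇒> ax≰by))))))

    -- The coordinates are integers because the vertex, and with it the point tried, may be
    -- negative; the claim says something only for naturals in range.
    Tried : ℕ → ℤ → ℤ → Assertion
    Tried β i j = Improved A β (λ β′ → ∀ {x y} → i ≡ + x → j ≡ + y → InRange a b m n x y →
                                       β′ ≤ objective a b m n x y)

    try-wp : ∀ s {β} → A β s → wp try (Tried β (s vx) (s vy)) s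
    try-wp s {β} anchored@(((a≡ , b≡ , m≡ , n≡) , _) , _) =
      (λ b≤x → (λ x≤m → (λ a≤y → (λ y≤n → attempt b≤x x≤m a≤y y≤n) ,
        (λ y≰n → reject λ { x≡ y≡ (_ , (_ , y≤n)) → y≰n (≤-value y≡ n≡ y≤n) })) ,
        (λ a≰y → reject λ { x≡ y≡ (_ , (a≤y , _)) → a≰y (≤-value a≡ y≡ a≤y) })) ,
        (λ x≰m → reject λ { x≡ y≡ ((_ , x≤m) , _) → x≰m (≤-value x≡ m≡ x≤m) })) ,
        (λ b≰x → reject λ { x≡ y≡ ((b≤x , _) , _) → b≰x (≤-value b≡ x≡ b≤x) })
      where
      reject : (∀ {x y} → s vx ≡ + x → s vy ≡ + y → ¬ InRange a b m n x y) → Tried β (s vx) (s vy) s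
      reject outside = β , anchored , ≤-refl , λ x≡ y≡ range → contradiction range (outside x≡ y≡)
      attempt : s vb ℤ.≤ s vx → s vx ℤ.≤ s vm → s va ℤ.≤ s vy → s vy ℤ.≤ s vn →
        wp update (Tried β (s vx) (s vy)) s
      -- The guards that bound `x` and `y` from below force both to be naturals.
      attempt b≤x x≤m a≤y y≤n with ≥-natural b≡ b≤x | ≥-natural a≡ a≤y
      ... | x , x≡ | y , y≡ = wp-mono update sharpen s
            (update-wp s ((≤-value⁻ b≡ x≡ b≤x , ≤-value⁻ x≡ m≡ x≤m) , (≤-value⁻ a≡ y≡ a≤y , ≤-value⁻ y≡ n≡ y≤n))
                       anchored x≡ y≡)
        where
        sharpen : ∀ s′ → Improved A β (_≤ objective a b m n x y) s′ → Tried β (s vx) (s vy) s′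
        sharpen _ (β′ , anchored′ , β′≤β , β′≤) = β′ , anchored′ , β′≤β , λ x′≡ y′≡ _ →
          ≤-trans β′≤ (≤-reflexive (cong₂ (objective a b m n)
            (ℤ.+-injective (trans (sym x≡) x′≡)) (ℤ.+-injective (trans (sym y≡) y′≡))))

    candidate-ensures : ∀ e s {β} → A β s →
      Ensures (candidate e) (Improved A β (λ β′ → ∀ {u} →
        eval e s ≡ + u → InRange a b m n (x₀ + q * u) (y₀ + p * u) →
                                             β′ ≤ objective a b m n (x₀ + q * u) (y₀ + p * u))) s
    candidate-ensures e s {β} anchored@((_ , p≡ , q≡ , _) , x₀≡ , y₀≡) =
      ensures (wp-mono try sharpen s″ (try-wp s″ anchored))
      where
      s′ s″ : Store
      s′ = s [ vt ↦ eval e s ] [ vx ↦ s vx₀ ℤ.+ s vq ℤ.* eval e s ]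
      s″ = s′ [ vy ↦ s vy₀ ℤ.+ s vp ℤ.* eval e s ]
      sharpen : ∀ s‴ → Tried β (s″ vx) (s″ vy) s‴ →
        Improved A β (λ β′ → ∀ {u} →
        eval e s ≡ + u → InRange a b m n (x₀ + q * u) (y₀ + p * u) →
                             β′ ≤ objective a b m n (x₀ + q * u) (y₀ + p * u)) s‴
      sharpen _ (β′ , anchored′ , β′≤β , β′≤) = β′ , anchored′ , β′≤β , λ u≡ →
        β′≤ (+-value x₀≡ (*-value q≡ u≡)) (+-value y₀≡ (*-value p≡ u≡))

  vertexPosition : ℕ → ℕ → ℤ
  vertexPosition x₀ y₀ =
    ((+ m ℤ.- + x₀) ℤ.* + p ℤ.+ (+ n ℤ.- + y₀) ℤ.* + q ℤ.+ + p ℤ.* + q ℤ.- + a ℤ.* + q) ÷ (+ 2 ℤ.* (+ p ℤ.* + q))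

  module Family .{{_ : NonZero p}} .{{_ : NonZero q}} (aq≡bp : a * q ≡ b * p) where

    open Ridge a b m n p q aq≡bp

    module _ {x₀ y₀ : ℕ} where

      private
        X Y : ℕ → ℕ
        X u = x₀ + q * u
        Y u = y₀ + p * u
        slopeSum : ℕ
        slopeSum = (m ∸ x₀) * p + (n ∸ y₀) * q + p * q
        2pq≢0 : NonZero (2 * (p * q))
        2pq≢0 = m*n≢0 2 (p * q) {{_}} {{m*n≢0 p q}}

      vertexPosition≡ : x₀ ≤ m → y₀ ≤ n →
        vertexPosition x₀ y₀ ≡ (+ slopeSum ℤ.- + (a * q)) ÷ (+ (2 * (p * q)))
      vertexPosition≡ x₀≤m y₀≤n = cong₂ _÷_
        (cong₂ ℤ._-_ (+-value (+-value x-part y-part) (*-value {k = p} refl refl))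
                     (*-value {k = a} {l = q} refl refl))
        (*-value {k = 2} refl (*-value {k = p} refl refl))
        where
        x-part : (+ m ℤ.- + x₀) ℤ.* + p ≡ + ((m ∸ x₀) * p)
        x-part = *-value (∸-value x₀≤m refl refl) refl
        y-part : (+ n ℤ.- + y₀) ℤ.* + q ≡ + ((n ∸ y₀) * q)
        y-part = *-value (∸-value y₀≤n refl refl) refl

      -- Each unit step lowers the slope sum by the second difference `2 * (p * q)`, which is why
      -- the vertex is a quotient by that number.
      slopeSum≡ : ∀ {u} → X u ≤ m → Y u ≤ n →
        slopeSum ≡ (m ∸ X u) * p + (n ∸ Y u) * q + p * q + u * (2 * (p * q))
      slopeSum≡ {u} X≤m Y≤n = trans (cong₂ (λ s t → s * p + t * q + p * q) (∸-gap q X≤m) (∸-gap p Y≤n))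
                                (regroup (m ∸ X u) (n ∸ Y u) p q u)
        where
        regroup : ∀ v w p q u →
          (v + q * u) * p + (w + p * u) * q + p * q ≡ v * p + w * q + p * q + u * (2 * (p * q))
        regroup = solve-∀

      before-vertex : ∀ {u} → X u ≤ m → Y u ≤ n → + u ℤ.≤ vertexPosition x₀ y₀ →
        a * q ≤ (m ∸ X u) * p + (n ∸ Y u) * q + p * q
      before-vertex {u} X≤m Y≤n u≤τ = +-cancelʳ-≤ (u * (2 * (p * q))) _ _ (begin
        a * q + u * (2 * (p * q))   ≡⟨ +-comm (a * q) _ ⟩
        u * (2 * (p * q)) + a * q   ≤⟨ ÷-≥ {slopeSum} {a * q} {2 * (p * q)} {{2pq≢0}}
            (subst (+ u ℤ.≤_) (vertexPosition≡ (m+n≤o⇒m≤o x₀ X≤m) (m+n≤o⇒m≤o y₀ Y≤n)) u≤τ) ⟩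
        slopeSum                    ≡⟨ slopeSum≡ X≤m Y≤n ⟩
        _                           ∎)
        where open ≤-Reasoning

      -- The floor yields a strict bound with `suc u`. One of the two `p * q` that this brings in
      -- cancels the one inside `slopeSum`; the other remains on the right.
      after-vertex : ∀ {u} → X u ≤ m → Y u ≤ n → vertexPosition x₀ y₀ ℤ.≤ + u →
        (m ∸ X u) * p + (n ∸ Y u) * q ≤ a * q + p * q
      after-vertex {u} X≤m Y≤n τ≤u = <⇒≤ (+-cancelʳ-< (p * q + u * (2 * (p * q))) _ _ (begin-strict
        v + (p * q + u * (2 * (p * q)))             ≡⟨ +-assoc v _ _ ⟨
        v + p * q + u * (2 * (p * q))               ≡⟨ slopeSum≡ X≤m Y≤n ⟨
        slopeSum                                    <⟨ ÷-≤ {slopeSum} {a * q} {2 * (p * q)} {{2pq≢0}}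
            (subst (ℤ._≤ + u) (vertexPosition≡ (m+n≤o⇒m≤o x₀ X≤m) (m+n≤o⇒m≤o y₀ Y≤n)) τ≤u) ⟩
        suc u * (2 * (p * q)) + a * q               ≡⟨ regroup (a * q) (p * q) (u * (2 * (p * q))) ⟩
        a * q + p * q + (p * q + u * (2 * (p * q))) ∎))
        where
        open ≤-Reasoning
        v : ℕ
        v = (m ∸ X u) * p + (n ∸ Y u) * q
        regroup : ∀ l d w → 2 * d + w + l ≡ l + d + (d + w)
        regroup = solve-∀

      module _ {r : ℕ} where

        private
          A : ℕ → Assertion
          A = Anchored r x₀ y₀

        FamilyPost : ℕ → Assertion
        FamilyPost β = Improved A β (λ β′ → ∀ {u} → Candidate x₀ y₀ (vertexPosition x₀ y₀) u →
                                            InRange a b m n (X u) (Y u) → β′ ≤ objective a b m n (X u) (Y u))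

        vertex-value : ∀ s {β} → A β s → eval vertexExpr s ≡ vertexPosition x₀ y₀
        vertex-value s (((a≡ , b≡ , m≡ , n≡) , p≡ , q≡ , _) , x₀≡ , y₀≡)
          rewrite a≡ | m≡ | n≡ | p≡ | q≡ | x₀≡ | y₀≡ = refl

        family-ensures : ∀ s {β} → A β s → Ensures family (FamilyPost β) s
        family-ensures s₀ {β} A₀ =
          ensures-⨾ (candidate-ensures c₀ s₀ A₀) λ s₁ (β₁ , A₁ , β₁≤β , try₀) →
          ensures-⨾ (candidate-ensures c₁ s₁ A₁) λ s₂ (β₂ , A₂ , β₂≤β₁ , try₁) →
          ensures-⨾ (candidate-ensures c₂ s₂ A₂) λ s₃ (β₃ , A₃ , β₃≤β₂ , try₂) →
          ensures-mono (λ s₄ (β₄ , A₄ , β₄≤β₃ , try₃) →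
            β₄ , A₄ , ≤-trans β₄≤β₃ (≤-trans β₃≤β₂ (≤-trans β₂≤β₁ β₁≤β)) , λ where
              first       range → ≤-trans β₄≤β₃ (≤-trans β₃≤β₂ (≤-trans β₂≤β₁ (try₀ refl range)))
              -- The program subtracts in the integers; a class point in range gives `y₀ ≤ n`, which
              -- makes the difference a natural.
              lastʸ       range@(_ , (_ , Y≤n)) → ≤-trans β₄≤β₃ (≤-trans β₃≤β₂ (try₁ (valueʸ s₁ β₁ A₁ Y≤n) range))
              lastˣ       range@((_ , X≤m) , _) → ≤-trans β₄≤β₃ (try₂ (valueˣ s₂ β₂ A₂ X≤m) range)
              (vertex τ≡) range → try₃ (trans (vertex-value s₃ A₃) τ≡) range)
          (candidate-ensures vertexExpr s₃ A₃)
          where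
          c₀ c₁ c₂ : Expr
          c₀ = # (+ 0)
          c₁ = (` vn ⊖ ` vy₀) ⊘ ` vp
          c₂ = (` vm ⊖ ` vx₀) ⊘ ` vq
          valueʸ : ∀ s β {v} → A β s → y₀ + p * v ≤ n → eval c₁ s ≡ + ((n ∸ y₀) / p)
          valueʸ _ _ (((_ , _ , _ , n≡) , p≡ , _) , _ , y₀≡) Y≤n =
            ÷-value (∸-value (m+n≤o⇒m≤o y₀ Y≤n) n≡ y₀≡) p≡
          valueˣ : ∀ s β {u} → A β s → x₀ + q * u ≤ m → eval c₂ s ≡ + ((m ∸ x₀) / q)
          valueˣ _ _ (((_ , _ , m≡ , _) , _ , q≡ , _) , x₀≡ , _) X≤m =
            ÷-value (∸-value (m+n≤o⇒m≤o x₀ X≤m) m≡ x₀≡) q≡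

        FamilyCovered : ℕ → Assertion
        FamilyCovered β = Improved A β (λ β′ → ∀ {t} →
          InRange a b m n (X t) (Y t) → β′ ≤ objective a b m n (X t) (Y t))

        -- `best-candidate` looks after the upper limits only. The lower ones hold on the whole
        -- class because its first point satisfies them.
        family-covers : b ≤ x₀ → a ≤ y₀ → ∀ s {β} → A β s → Ensures family (FamilyCovered β) s
        family-covers b≤x₀ a≤y₀ s {β} anchored = ensures-mono covered (family-ensures s anchored)
          where
          covered : ∀ s → FamilyPost β s → FamilyCovered β s
          covered _ (β′ , anchored′ , β′≤β , β′≤) = β′ , anchored′ , β′≤β , λ {t} ((_ , X≤m) , (_ , Y≤n)) →
            let u , c , (Xu≤m , Yu≤n) , best = best-candidate x₀ y₀ (vertexPosition x₀ y₀)
                  (λ (X≤m , Y≤n) → before-vertex X≤m Y≤n) (λ (X≤m , Y≤n) → after-vertex X≤m Y≤n) {t} (X≤m , Y≤n)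
            in ≤-trans (β′≤ c ((≤-trans b≤x₀ (m≤m+n x₀ _) , Xu≤m) , (≤-trans a≤y₀ (m≤m+n y₀ _) , Yu≤n))) best

Minimized : (a b m n : ℕ) → Assertion
Minimized a b m n s = ∃[ k ] s va ≡ + k × k IsMinimumOf ObjectiveValue a b m n

-- The 2 is the cost of the loop test: one addition and one comparison.
residuesBound : ℕ
residuesBound = 2 + worstCost body

module _ (a b m n p q : ℕ) .{{_ : NonZero a}} .{{_ : NonZero p}} .{{_ : NonZero q}}
         (aq≡bp : a * q ≡ b * p) where

  open Search a b m n p q
  open Family aq≡bp

  Beats : ℕ → ℕ → Set
  Beats r β = ∀ ρ t → InRange a b m n (round ρ a b (a + r) + q * t) (a + r + p * t) →
              β ≤ objective a b m n (round ρ a b (a + r) + q * t) (a + r + p * t)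

  BodyPost : ℕ → ℕ → Assertion
  BodyPost r β = Improved (Searching (suc r)) β (Beats r)

  body-ensures : ∀ r s {β} → Searching r β s → Ensures body (BodyPost r β) s
  body-ensures r s {β} searching@((a≡ , b≡ , m≡ , n≡) , _ , _ , r≡ , _) =
    ensures-:= (ensures-:= (ensures-⨾
      (family-covers (round-≥ a b m n down (m≤m+n a r)) (m≤m+n a r) _
        (searching , ÷-value (*-value b≡ (+-value a≡ r≡)) a≡ , +-value a≡ r≡))
      λ s₁ (β₁ , A₁@(searching₁ , _ , y₀≡₁) , β₁≤β , covers₁) → ensures-:= (ensures-⨾
      (family-covers (round-≥ a b m n up (m≤m+n a r)) (m≤m+n a r) _
        (searching₁ , up-value s₁ A₁ , y₀≡₁))
      λ s₂ (β₂ , ((inputs₂ , p≡₂ , q≡₂ , r≡₂ , best₂) , _) , β₂≤β₁ , covers₂) → ensures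
        (β₂ , (inputs₂ , p≡₂ , q≡₂ , trans (+-value r≡₂ refl) (cong +_ (+-comm r 1)) , best₂) ,
         ≤-trans β₂≤β₁ β₁≤β , λ where
          down _ range → ≤-trans β₂≤β₁ (covers₁ range)
          up   _ range → covers₂ range))))
    where
    upExpr : Expr
    upExpr = (` vb ⊗ ` vy₀ ⊕ (` va ⊖ # (+ 1))) ⊘ ` va
    up-value : ∀ s {x₀ β} → Anchored r x₀ (a + r) β s → eval upExpr s ≡ + round up a b (a + r)
    up-value s (((a≡ , b≡ , _) , _) , _ , y₀≡) =
      ÷-value (+-value (*-value b≡ y₀≡) (∸-value (>-nonZero⁻¹ a) a≡ refl)) a≡

  Scanned : ℕ → Assertion
  Scanned r s = ∃[ β ] Searching r β s × β ≤ a * m × (∀ {r′} → r′ < r → Beats r′ β)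

  -- Every y ≥ a is a + r + p t with r < p, and rounding commutes with the shift by t.
  scanned-minimum : ∀ {r β} → p ≤ r → β ≤ a * m → (∀ {r′} → r′ < r → Beats r′ β) →
    ∀ {x y} → InRange a b m n x y → β ≤ objective a b m n x y
  scanned-minimum {r} {β} p≤r β≤am beats {x} {y} ((b≤x , x≤m) , (a≤y , y≤n)) with next-to-ridge a b m n x≤m y≤n
  ... | inj₁ am≤ = ≤-trans β≤am am≤
  ... | inj₂ (ρ , x̂≤m , x̂≤) = ≤-trans (subst₂ (λ x y → InRange a b m n x y → β ≤ objective a b m n x y) x̂≡ y≡
      (beats (<-≤-trans (m%n<n (y ∸ a) p) p≤r) ρ ((y ∸ a) / p)) ((round-≥ a b m n ρ a≤y , x̂≤m) , (a≤y , y≤n))) x̂≤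
    where
    y≡ : a + (y ∸ a) % p + p * ((y ∸ a) / p) ≡ y
    y≡ = begin
      a + (y ∸ a) % p + p * ((y ∸ a) / p)    ≡⟨ +-assoc a _ _ ⟩
      a + ((y ∸ a) % p + p * ((y ∸ a) / p))  ≡⟨ cong (λ t → a + ((y ∸ a) % p + t)) (*-comm p _) ⟩
      a + ((y ∸ a) % p + (y ∸ a) / p * p)    ≡⟨ cong (λ t → a + t) (m≡m%n+[m/n]*n (y ∸ a) p) ⟨
      a + (y ∸ a)                            ≡⟨ m+[n∸m]≡n a≤y ⟩
      y                                      ∎
      where open ≡-Reasoning
    x̂≡ : round ρ a b (a + (y ∸ a) % p) + q * ((y ∸ a) / p) ≡ round ρ a b y
    x̂≡ = trans (sym (round-shift a b m n ρ aq≡bp _ ((y ∸ a) / p))) (cong (λ y → round ρ a b y) y≡)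

  -- The loop makes at most `p` iterations and one failing test; the final `+ 0` is the free copy
  -- into the output variable.
  residues-halts : ∀ s → Scanned 0 s →
    Halts (residues ⨾ va := ` vbest) s (Minimized a b m n) (suc p * residuesBound + 0)
  residues-halts s start = halts-⨾
    (while-halts (` vr ⊕ # (+ 1) ≤ᵉ ` vp) body Scanned p tt step p 0 (m≤m+n p 0) start)
    λ s′ (r≮p , r , β , ((_ , p≡ , _ , r≡ , β≡ , attained)) , β≤am , beats) →
    ensures-halts (va := ` vbest) tt (ensures
      (β , β≡ , attained , λ { _ (x , y , x∈ , y∈ , refl) →
        scanned-minimum (≮⇒≥ λ r<p → r≮p (≤-value (trans (+-value r≡ refl) (cong +_ (+-comm r 1))) p≡ r<p))
          β≤am beats (x∈ , y∈) }))
    where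
    step : ∀ r {s} → Scanned r s → Holds (` vr ⊕ # (+ 1) ≤ᵉ ` vp) s →
      r < p × Ensures body (Scanned (suc r)) s
    step r {s} (β , searching@(_ , p≡ , _ , r≡ , _) , β≤am , beats) r<p =
      ≤-value⁻ (trans (+-value r≡ refl) (cong +_ (+-comm r 1))) p≡ r<p ,
      ensures-mono scan (body-ensures r s searching)
      where
      scan : ∀ s′ → BodyPost r β s′ → Scanned (suc r) s′
      scan _ (β′ , searching′ , β′≤β , beats′) = β′ , searching′ , ≤-trans β′≤β β≤am ,
        λ {r′} r′<1+r → [ (λ r′<r ρ t range → ≤-trans β′≤β (beats r′<r ρ t range)) , (λ { refl → beats′ }) ]′
                          (m<1+n⇒m<n∨m≡n r′<1+r)

-- The search for the period and the total running time

searchBound : ℕ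
searchBound = testCost searchTest + worstCost searchStep

module _ (a b m n N : ℕ) .{{_ : NonZero a}} .{{_ : NonZero b}} 
         (a≤n : a ≤ n) (b≤m : b ≤ m) (a∣bG : a ∣ b * suc N) where

  private
    Counting : ℕ → Assertion
    Counting i s = Inputs a b m n s × s vp ≡ + suc i × i ≤ N

    quotient-value : ∀ i s → Counting i s → eval ((` vb ⊗ ` vp) ⊘ ` va) s ≡ + (b * suc i / a)
    quotient-value i s ((a≡ , b≡ , _) , p≡ , _) = ÷-value (*-value b≡ p≡) a≡

    rest-value : ∀ i s → Counting i s →
      eval (` vb ⊗ ` vp ⊖ ` va ⊗ ((` vb ⊗ ` vp) ⊘ ` va)) s ≡ + (b * suc i ∸ a * (b * suc i / a))
    rest-value i s counting@((a≡ , b≡ , _) , p≡ , _) =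
      ∸-value (≤-trans (≤-reflexive (*-comm a _)) (m/n*n≤m (b * suc i) a))
              (*-value b≡ p≡) (*-value a≡ (quotient-value i s counting))

    divisible⇒rest≡0 : ∀ {k} → a ∣ k → k ∸ a * (k / a) ≡ 0
    divisible⇒rest≡0 (divides c refl) = m≤n⇒m∸n≡0 (≤-reflexive (trans (*-comm c a) (cong (a *_) (sym (m*n/n≡m c a)))))

  -- Since `a ∣ b * suc N`, the search has stopped when `vp` reaches `suc N`. The sequel draws on
  -- `i ≤ N` for the cost and on the failed test for `a ∣ b * p`.
  search-halts : ∀ s → Inputs a b m n s → s vp ≡ + 1 →
    Halts search s (λ s′ → ¬ Holds searchTest s′ × ∃[ i ] Counting i s′) (suc N * searchBound)
  search-halts s inputs p≡ =
    while-halts searchTest searchStep Counting N tt step N 0 (m≤m+n N 0) (inputs , p≡ , z≤n)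
    where
    step : ∀ i {s} → Counting i s → Holds searchTest s → i < N × Ensures searchStep (Counting (suc i)) s
    step i {s} counting@(inputs , p≡ , i≤N) undivided = i<N ,
      ensures (inputs , trans (+-value p≡ refl) (cong +_ (+-comm (suc i) 1)) , i<N)
      where
      i<N : i < N
      -- At `i ≡ N` the remainder would be 0, whereas the test has found it to be at least 1.
      i<N = ≤∧≢⇒< i≤N λ { refl → contradiction
        (≤-trans (≤-value⁻ {k = 1} refl (rest-value i s counting) undivided)
                 (≤-reflexive (divisible⇒rest≡0 a∣bG))) (λ ()) }

  minimise-halts : ∀ s → Inputs a b m n s → s vp ≡ + 1 →
    Halts (search ⨾ init ⨾ residues ⨾ va := ` vbest) s (Minimized a b m n)
          (suc N * searchBound + (worstCost init + (suc (suc N) * residuesBound + 0)))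
  minimise-halts s inputs p≡ = halts-⨾ (search-halts s inputs p≡) divided
    where
    divided : ∀ s → ¬ Holds searchTest s × ∃[ i ] Counting i s →
      Halts (init ⨾ residues ⨾ va := ` vbest) s (Minimized a b m n)
            (worstCost init + (suc (suc N) * residuesBound + 0))
    divided s (divided , i , counting@(inputs@(a≡ , b≡ , m≡ , n≡) , p≡ , i≤N)) =
      scan (b * p / a) {{q≢0}} aq≡bp (quotient-value i s counting)
      where
      p : ℕ
      p = suc i
      aq≡bp : a * (b * p / a) ≡ b * p
      aq≡bp = ≤-antisym (≤-trans (≤-reflexive (*-comm a _)) (m/n*n≤m (b * p) a))
        (m∸n≡0⇒m≤n (n<1⇒n≡0 (≰⇒> (divided ∘ ≤-value refl (rest-value i s counting)))))
      q≢0 : NonZero (b * p / a)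
      q≢0 = m*n≢0⇒n≢0 a {{subst NonZero (sym aq≡bp) (m*n≢0 b p)}}
      scan : ∀ q .{{_ : NonZero q}} → a * q ≡ b * p → eval ((` vb ⊗ ` vp) ⊘ ` va) s ≡ + q →
        Halts (init ⨾ residues ⨾ va := ` vbest) s (Minimized a b m n)
              (worstCost init + (suc (suc N) * residuesBound + 0))
      scan q aq≡bp q≡ = halts-⨾ (ensures-halts init tt start) λ s′ scanned →
        halts-mono (λ post → post) (+-monoˡ-≤ 0 (*-monoˡ-≤ residuesBound (s≤s (s≤s i≤N))))
                   (residues-halts a b m n p q aq≡bp s′ scanned)
        where
        -- Shows that the starting value of `vbest` is attained: the product vanishes at `x = m`,
        -- and `b ≤ m` makes `a * m` the larger weight.
        corner : objective a b m n m a ≡ a * m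
        corner = cong₂ _+_ (cong (_* (n ∸ a)) (n∸n≡0 m))
          (m≥n⇒m⊔n≡m (≤-trans (≤-reflexive (*-comm b a)) (*-monoʳ-≤ a b≤m)))
        start : Ensures init (Scanned a b m n p q aq≡bp 0) s
        start = ensures (a * m , (inputs , p≡ , q≡ , refl , *-value a≡ m≡ ,
          (m , a , (b≤m , ≤-refl) , (≤-refl , a≤n) , sym corner)) , ≤-refl , λ ())

objective-swap : ∀ a b m n x y → objective a b m n x y ≡ objective b a n m y x
objective-swap a b m n x y = cong₂ _+_ (*-comm (m ∸ x) (n ∸ y)) (⊔-comm (a * x) (b * y))

minimum-swap : ∀ {a b m n k} → k IsMinimumOf ObjectiveValue b a n m → k IsMinimumOf ObjectiveValue a b m n
minimum-swap {a} {b} {m} {n} ((y , x , y∈ , x∈ , k≡) , least) =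
  (x , y , x∈ , y∈ , trans k≡ (objective-swap b a n m y x)) ,
  λ { l (x , y , x∈ , y∈ , l≡) → least l (y , x , y∈ , x∈ , trans l≡ (objective-swap a b m n x y)) }

minimum-unique : ∀ {P k l} → k IsMinimumOf P → l IsMinimumOf P → k ≡ l
minimum-unique (Pk , k≤) (Pl , l≤) = ≤-antisym (k≤ _ Pl) (l≤ _ Pk)

-- Moving the factor `g` across, `b * (a / g)` is `a` times the integer `b / g`.
∣*/gcd : ∀ {a b g} .{{_ : NonZero g}} → g ∣ a → g ∣ b → a ∣ b * (a / g)
∣*/gcd {g = g} (divides c refl) (divides d refl) = divides d (begin
  d * g * (c * g / g)  ≡⟨ cong (d * g *_) (m*n/n≡m c g) ⟩
  d * g * c            ≡⟨ trans (*-assoc d g c) (cong (d *_) (*-comm g c)) ⟩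
  d * (c * g)          ∎)
  where open ≡-Reasoning

-- The factor 2 absorbs the additional share of the residue loop, as `suc G ≤ 2 * G` for `G ≥ 1`;
-- the one-time costs of `setup` and `init` are likewise at most `G` times themselves.
algorithmConstant : ℕ
algorithmConstant = worstCost setup + (searchBound + (worstCost init + 2 * residuesBound))

module _ (a b m n : ℕ) .{{_ : NonZero a}} .{{_ : NonZero b}} (a≤n : a ≤ n) (b≤m : b ≤ m) where

  private
    G : ℕ
    G = (a ⊓ b) / gcd a b

    Ordered : Assertion
    Ordered s = s vp ≡ + 1 × (a ≤ b × Inputs a b m n s ⊎ b ≤ a × Inputs b a n m s)

    setup-ensures : Ensures setup Ordered (input a b m n)
    setup-ensures = ensures
      ((λ a≤b → refl , inj₁ (ℤ.drop‿+≤+ a≤b , refl , refl , refl , refl)) ,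
       (λ a≰b → refl , inj₂ (<⇒≤ (≰⇒> (a≰b ∘ ℤ.+≤+)) , refl , refl , refl , refl)))

    1≤G : 1 ≤ G
    1≤G = m≥n⇒m/n>0 (⊓-glb (∣⇒≤ (gcd[m,n]∣m a b)) (∣⇒≤ (gcd[m,n]∣n a b)))

    bound : ∀ c₀ c₁ c₂ c₃ G → 1 ≤ G → c₀ + (G * c₁ + (c₂ + (suc G * c₃ + 0))) ≤ (c₀ + (c₁ + (c₂ + 2 * c₃))) * G
    bound c₀ c₁ c₂ c₃ (suc N) _ = ≤-trans (m≤m+n _ (N * (c₀ + c₂ + c₃))) (≤-reflexive (regroup c₀ c₁ c₂ c₃ N))
      where
      regroup : ∀ c₀ c₁ c₂ c₃ N → c₀ + ((1 + N) * c₁ + (c₂ + ((2 + N) * c₃ + 0))) + N * (c₀ + c₂ + c₃) ≡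
                                  (c₀ + (c₁ + (c₂ + 2 * c₃))) * (1 + N)
      regroup = solve-∀

  algorithm-halts : Halts algorithm (input a b m n) (Minimized a b m n) (algorithmConstant * G)
  algorithm-halts = halts-mono (λ post → post)
    (bound (worstCost setup) searchBound (worstCost init) residuesBound G 1≤G)
    (halts-⨾ (ensures-halts setup tt setup-ensures) continue)
    where
    continue : ∀ s → Ordered s → Halts (search ⨾ init ⨾ residues ⨾ va := ` vbest) s (Minimized a b m n)
      (G * searchBound + (worstCost init + (suc G * residuesBound + 0)))
    -- The positive number `G` is matched as `suc N`, the form in which `minimise-halts` takes the
    -- limit of the search.
    continue s (p≡ , ordered) with G in G≡ | 1≤G
    continue s (p≡ , inj₁ (a≤b , inputs)) | suc N | _ = minimise-halts a b m n N a≤n b≤m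
      (subst (λ t → a ∣ b * t) (trans (cong (_/ gcd a b) (sym (m≤n⇒m⊓n≡m a≤b))) G≡)
        (∣*/gcd (gcd[m,n]∣m a b) (gcd[m,n]∣n a b)))
      s inputs p≡
    continue s (p≡ , inj₂ (b≤a , inputs)) | suc N | _ =
      halts-mono (λ (k , k≡ , minimum) → k , k≡ , minimum-swap minimum) ≤-refl (minimise-halts b a n m N b≤m a≤n
      (subst (λ t → b ∣ a * t) (trans (cong (_/ gcd a b) (sym (m≥n⇒m⊓n≡n b≤a))) G≡)
        (∣*/gcd (gcd[m,n]∣n a b) (gcd[m,n]∣m a b)))
      s inputs p≡)

  algorithm-yields-γ : algorithm onInput input a b m n yields γ (R a b) m n within (algorithmConstant * G)
  algorithm-yields-γ with algorithm-halts
  ... | t , s′ , algorithm⇓ , (k , k≡ , minimum) , t≤ =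
    t , s′ , algorithm⇓ , trans k≡ (cong +_ (minimum-unique minimum (γ-minimum a b m n a≤n b≤m))) , t≤

theorem1p2 : (∀ a b m n .{{_ : NonZero a}} .{{_ : NonZero b}} .{{_ : NonZero m}} .{{_ : NonZero n}} →
    a ≤ n → b ≤ m →
    γ (R a b) m n IsMinimumOf ObjectiveValue a b m n)
    × (∃[ P ] ∃[ C ]
    ∀ a b m n .{{_ : NonZero a}} .{{_ : NonZero b}} .{{_ : NonZero m}} .{{_ : NonZero n}} →
    a ≤ n → b ≤ m →
    P onInput input a b m n yields γ (R a b) m n within (C * ((a ⊓ b) / gcd a b)))
    × (∀ a n .{{_ : NonZero a}} .{{_ : NonZero n}} → a ≤ n →
    (2 ∣ a → 3 * a ≤ 2 * n →
    γ (R a a) n n ≡ a * n ∸ a ^ 2 / 4)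
    × (2 ∤ a → 3 * a ≤ 2 * n + 1 →
    γ (R a a) n n ≡ a * n ∸ (a ^ 2 ∸ 1) / 4)
    × (¬ (2 ∣ a × 3 * a ≤ 2 * n) → ¬ (2 ∤ a × 3 * a ≤ 2 * n + 1) →
    γ (R a a) n n ≡ a ^ 2 + (n ∸ a) ^ 2))
theorem1p2 =
  (λ a b m n a≤n b≤m → γ-minimum a b m n a≤n b≤m) ,
  (algorithm , algorithmConstant , λ a b m n a≤n b≤m → algorithm-yields-γ a b m n a≤n b≤m) ,
  λ a n a≤n → γ-even a n a≤n , γ-odd a n a≤n , γ-otherwise a n a≤n
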